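{- Let $n\geq 3$ and let $G=(V,E)$ be a forest with $n$ vertices, with a fixed partition $E=E_{\mathrm{refl}}\sqcup E_{\mathrm{refr}}$ of its edge set into reflection edges and refraction edges. Let $(\sigma,i,\epsilon)\in\Xi_G$, and let $T=(V_T,E_T)$ be the connected component of $G$ containing the vertex $\sigma^{ -1}\!\left(i+\tfrac{1}{2}(1-\epsilon)\right)$. Then the orbit of $\Theta$ containing $(\sigma,i,\epsilon)$ has size \[\frac{|V_T|\,n(n-1)}{\gcd\!\left(n,\chi(T;E_{\mathrm{refl}},E_{\mathrm{refr}})\right)}.\]
   Context: For $i\in\mathbb{Z}/n\mathbb{Z}$, $s_i$ denotes the transposition of $\mathbb{Z}/n\mathbb{Z}$ swapping $i$ and $i+1$ (so $s_n$ swaps $n$ and $1$). A labeling of a graph $G=(V,E)$ with $n$ vertices is a bijection $V\to\mathbb{Z}/n\mathbb{Z}$; $\Lambda_G$ is the set of labelings. Given a partition $E=E_{\mathrm{refl}}\sqcup E_{\mathrm{refr}}$, let $\Xi_G=\Lambda_G\times\mathbb{Z}/n\mathbb{Z}\times\{\pm1\}$ and define $\Theta\colon\Xi_G\to\Xi_G$ by $\Theta(\sigma,i,\epsilon)=(s_i\circ\sigma,i+\epsilon,\epsilon)$ if $\{\sigma^{ -1}(i),\sigma^{ -1}(i+1)\}\notin E$; $\Theta(\sigma,i,\epsilon)=(\sigma,i+\epsilon,\epsilon)$ if $\{\sigma^{ -1}(i),\sigma^{ -1}(i+1)\}\in E_{\mathrm{refl}}$; and $\Theta(\sigma,i,\epsilon)=(s_i\circ\sigma,i-\epsilon,-\epsilon)$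 if $\{\sigma^{ -1}(i),\sigma^{ -1}(i+1)\}\in E_{\mathrm{refr}}$. ($\Theta$ is a bijection.) Here $i+\tfrac12(1-\epsilon)$ means $i$ if $\epsilon=1$ and $i+1$ if $\epsilon=-1$. For a tree component $T=(V_T,E_T)$ of a forest $G$, there is a partition $V_T=X_1\sqcup X_{ -1}$, unique up to swapping the two parts, such that every edge of $E_{\mathrm{refr}}\cap E_T$ has one endpoint in each part and every edge of $E_{\mathrm{refl}}\cap E_T$ has both endpoints in the same part; define $\chi(T;E_{\mathrm{refl}},E_{\mathrm{refr}})=\big||X_1|-|X_{ -1}|\big|$. -}

module Defs where

open import Data.Nat using (ℕ; zero; suc; _<_; _≤_; _*_; _∸_; ∣_-_∣)
open import Data.Nat.DivMod using (_%_; m%n<n)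
open import Data.Nat.GCD using (gcd)
open import Data.Fin using (Fin; toℕ; fromℕ<)
open import Data.Fin.Permutation using (Permutation′; _⟨$⟩ʳ_; _⟨$⟩ˡ_; _∘ₚ_; transpose)
open import Data.Sign using (Sign; +; -; opposite)
open import Data.Bool using (Bool; not)
open import Data.List using (List; length; filterᵇ)
open import Data.List.Membership.Propositional using (_∈_)
open import Data.List.Relation.Unary.Unique.Propositional using (Unique)
open import Data.Product using (_×_; _,_; Σ)
open import Function.Definitions using (Injective)
open import Relation.Binary.PropositionalEquality using (_≡_)
open import Relation.Nullary using (¬_)

-- ℤ/nℤ is modelled by Fin n (residues 0,…,n-1; the paper's label n is 0).

sucMod : ∀ {n} → Fin n → Fin n
sucMod {suc m} i = fromℕ< (m%n<n (suc (toℕ i)) (suc m))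

predMod : ∀ {n} → Fin n → Fin n
predMod {suc m} i = fromℕ< (m%n<n (toℕ i Data.Nat.+ m) (suc m))

stepMod : ∀ {n} → Sign → Fin n → Fin n
stepMod + i = sucMod i
stepMod - i = predMod i

-- i + (1 - ε)/2
halfShift : ∀ {n} → Sign → Fin n → Fin n
halfShift + i = i
halfShift - i = sucMod i

-- A simple graph on vertex set Fin n together with a partition of its
-- edge set into reflection and refraction edges, encoded as a function
-- assigning to each pair of vertices its edge type.

data EdgeType : Set where
  nonEdge reflEdge refrEdge : EdgeType

EdgeLabel : ℕ → Set
EdgeLabel n = Fin n → Fin n → EdgeType

IsSimple : ∀ {n} → EdgeLabel n → Set
IsSimple {n} G = (∀ (u v : Fin n) → G u v ≡ G v u) × (∀ (u : Fin n) → G u u ≡ nonEdge)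

Adj : ∀ {n} → EdgeLabel n → Fin n → Fin n → Set
Adj G u v = ¬ (G u v ≡ nonEdge)

IsCycle : ∀ {n} → EdgeLabel n → (k : ℕ) → (Fin k → Fin n) → Set
IsCycle G k f = (3 ≤ k) × Injective _≡_ _≡_ f × (∀ j → Adj G (f j) (f (sucMod j)))

IsForest : ∀ {n} → EdgeLabel n → Set
IsForest {n} G = ∀ (k : ℕ) (f : Fin k → Fin n) → ¬ IsCycle G k f

data Reach {n} (G : EdgeLabel n) : Fin n → Fin n → Set where
  here  : ∀ {u} → Reach G u u
  there : ∀ {u v w} → Adj G u v → Reach G v w → Reach G u w

-- The map Θ on Ξ_G = Λ_G × ℤ/nℤ × {±1}.
-- A labeling σ : V → ℤ/nℤ is a permutation of Fin n (σ ⟨$⟩ʳ v is the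
-- label of v, σ ⟨$⟩ˡ i = σ⁻¹(i)).

Ξ : ℕ → Set
Ξ n = Permutation′ n × Fin n × Sign

-- s_i ∘ σ   (π₁ ∘ₚ π₂ applies π₁ first)
applyS : ∀ {n} → Fin n → Permutation′ n → Permutation′ n
applyS i σ = σ ∘ₚ transpose i (sucMod i)

ΘCase : ∀ {n} → EdgeType → Ξ n → Ξ n
ΘCase nonEdge  (σ , i , ε) = (applyS i σ , stepMod ε i , ε)
ΘCase reflEdge (σ , i , ε) = (σ , stepMod ε i , ε)
ΘCase refrEdge (σ , i , ε) = (applyS i σ , stepMod (opposite ε) i , opposite ε)

Θ : ∀ {n} → EdgeLabel n → Ξ n → Ξ n
Θ G (σ , i , ε) = ΘCase (G (σ ⟨$⟩ˡ i) (σ ⟨$⟩ˡ sucMod i)) (σ , i , ε)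

_≈Ξ_ : ∀ {n} → Ξ n → Ξ n → Set
(σ , i , ε) ≈Ξ (τ , j , δ) = (∀ v → σ ⟨$⟩ʳ v ≡ τ ⟨$⟩ʳ v) × i ≡ j × ε ≡ δ

iterate : ∀ {A : Set} → (A → A) → ℕ → A → A
iterate f zero x = x
iterate f (suc k) x = f (iterate f k x)

-- the Θ-orbit of ξ has exactly N elements (for a bijection of a finite
-- set, this is the least N > 0 with Θ^N ξ = ξ)
OrbitSize : ∀ {n} → EdgeLabel n → Ξ n → ℕ → Set
OrbitSize G ξ N =
  (0 < N) × (iterate (Θ G) N ξ ≈Ξ ξ) ×
  (∀ j → 0 < j → j < N → ¬ (iterate (Θ G) j ξ ≈Ξ ξ))

IsComponentList : ∀ {n} → EdgeLabel n → Fin n → List (Fin n) → Set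
IsComponentList {n} G x L =
  Unique L × (∀ (y : Fin n) → (y ∈ L → Reach G x y) × (Reach G x y → y ∈ L))

-- A partition V_T = X₁ ⊔ X₋₁ (X₁ = vertices coloured true) such that
-- refraction edges of T cross and reflection edges of T do not.
IsReflRefrPartition : ∀ {n} → EdgeLabel n → Fin n → (Fin n → Bool) → Set
IsReflRefrPartition {n} G x c =
  ∀ (u v : Fin n) → Reach G x u →
    (G u v ≡ reflEdge → c u ≡ c v) × (G u v ≡ refrEdge → ¬ (c u ≡ c v))

chi : ∀ {n} → List (Fin n) → (Fin n → Bool) → ℕ
chi L c = ∣ length (filterᵇ c L) - length (filterᵇ (λ v → not (c v)) L) ∣

{-# OPTIONS --safe #-}

-- Call x = σ⁻¹(i + (1 − ε)/2) the stone. Relative to the stone, the other n − 1 vertices sit in slots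
-- indexed by ℤ/(n − 1). A non-edge moves the stone past a slot; an edge makes the occupant y of the
-- slot the new stone and leaves x in that slot, so every edge keeps its slot, and since G is a forest
-- the occupants of the slots depend only on the stone. Lifting i to ℤ, the dynamics becomes
-- (x , i) ↦ (x′ , i + ε(x′)), where x′ is the stone after slot i and ε(x′) is read off the two-colouring.
-- On V_T × ℤ/(n − 1) this is a single cycle: an edge crossed in one direction must be crossed back
-- before the stone returns, so a visit to (x , i) entails a visit to (x , i + ε(x)) and to all
-- neighbours of x. One lap therefore takes |V_T| (n − 1) steps and shifts i by (n − 1) Σ ε(v) = ± (n − 1) χ,
-- which is ∓ χ modulo n, so the first exact return comes after n / gcd(n , χ) laps.
module Submission where

open import Defs
open import Data.Nat using (ℕ; _≤_; _*_; _∸_)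
open import Data.Nat.GCD using (gcd)
open import Data.Fin using (Fin)
open import Data.Fin.Permutation using (Permutation′; _⟨$⟩ˡ_)
open import Data.Sign using (Sign)
open import Data.Bool using (Bool)
open import Data.List using (List; length)
open import Data.Product using (_,_; _×_; Σ-syntax)
open import Relation.Binary.PropositionalEquality using (_≡_)

open import Data.Bool using (true; false; not)
open import Data.Empty using (⊥)
import Data.Fin as Fin
import Data.Fin.Properties as Fin
open import Data.Fin using (toℕ)
open import Data.Fin.Permutation using (_⟨$⟩ʳ_; inverseˡ; inverseʳ)
open import Data.Fin.Permutation.Components using (transpose; transpose-inverse)
open import Data.Fin.Properties using (_≟_)
open import Data.List using ([]; _∷_; _++_; map; filterᵇ; lookup; applyDownFrom; allFin; cartesianProduct)
open import Data.List.Membership.DecPropositional using (_∈?_)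
open import Data.List.Membership.Propositional using (_∈_)
open import Data.List.Membership.Propositional.Properties
  using (∈-∃++; ∈-lookup; ∈-allFin; ∈-applyDownFrom⁺; ∈-applyDownFrom⁻; ∈-cartesianProduct⁺; ∈-cartesianProduct⁻)
open import Data.List.Membership.Propositional.Properties.WithK using (unique∧set⇒bag)
open import Data.List.Properties
  using (length-++; length-map; map-++; map-∘; length-applyDownFrom; map-applyDownFrom; length-tabulate)
open import Data.List.Relation.Binary.BagAndSetEquality using (∼bag⇒↭)
open import Data.List.Relation.Binary.Permutation.Propositional using (_↭_)
open import Data.List.Relation.Binary.Permutation.Propositional.Properties
  using (↭-length) renaming (map⁺ to ↭-map⁺)
open import Data.List.Relation.Unary.All as All using (All; []; _∷_)
open import Data.List.Relation.Unary.All.Properties using (++⁻ˡ; ++⁻ʳ; ¬Any⇒All¬)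
open import Data.List.Relation.Unary.AllPairs using ([]; _∷_)
open import Data.List.Relation.Unary.Any using (here; there)
open import Data.List.Relation.Unary.Unique.Propositional using (Unique)
open import Data.List.Relation.Unary.Unique.Propositional.Properties
  using (applyDownFrom⁺₁; cartesianProduct⁺; allFin⁺)
open import Data.Nat using (zero; suc; pred; _+_; _<_; z≤n; s≤s; NonZero; >-nonZero; ∣_-_∣)
open import Data.Nat.Divisibility using (_∣_; divides; ∣⇒≤; m%n≡0⇒n∣m; *-cancelʳ-∣)
open import Data.Nat.DivMod
open import Data.Nat.GCD using (gcd[m,n]∣m; gcd[m,n]∣n; gcd-greatest; c*gcd[m,n]≡gcd[cm,cn])
open import Data.Nat.ListAction using (sum)
open import Data.Nat.ListAction.Properties using (sum-++; sum-↭)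
import Data.Nat.Properties as ℕ
open import Data.Nat.Tactic.RingSolver using (solve-∀)
open import Data.Product using (Σ; proj₁; proj₂; ∃-syntax)
import Data.Sign as Sign
open import Data.Sign using (opposite)
open import Data.Sign.Properties using (opposite-involutive)
open import Data.Sum using (_⊎_; inj₁; inj₂)
open import Data.Unit using (⊤; tt)
open import Function using (_∘_; mk⇔)
open import Relation.Binary.PropositionalEquality
  using (_≢_; refl; sym; trans; cong; cong₂; subst; subst₂; module ≡-Reasoning)
open import Relation.Nullary using (¬_; Dec; yes; no; contradiction)
open import Relation.Nullary.Decidable using (dec-true; dec-false)
open import Relation.Unary using (Decidable)

-- Transpositions of `Fin n`.

transpose-ˡ : ∀ {n} (u v : Fin n) → transpose u v u ≡ v
transpose-ˡ u v rewrite dec-true (u ≟ u) refl = refl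

transpose-ʳ : ∀ {n} (u v : Fin n) → transpose u v v ≡ u
transpose-ʳ u v with v ≟ u
... | yes v≡u = v≡u
... | no _ rewrite dec-true (v ≟ v) refl = refl

transpose-≢ : ∀ {n} {u v w : Fin n} → w ≢ u → w ≢ v → transpose u v w ≡ w
transpose-≢ {u = u} {v} {w} w≢u w≢v rewrite dec-false (w ≟ u) w≢u | dec-false (w ≟ v) w≢v = refl

transpose-comm : ∀ {n} (u v w : Fin n) → transpose u v w ≡ transpose v u w
transpose-comm u v w = by-cases (w ≟ u) (w ≟ v)
  where
  by-cases : Dec (w ≡ u) → Dec (w ≡ v) → transpose u v w ≡ transpose v u w
  by-cases (yes refl) _          = trans (transpose-ˡ w v) (sym (transpose-ʳ v w))
  by-cases (no _)     (yes refl) = trans (transpose-ʳ u w) (sym (transpose-ˡ w u))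
  by-cases (no w≢u)   (no w≢v)   = trans (transpose-≢ w≢u w≢v) (sym (transpose-≢ w≢v w≢u))

transpose-involutive : ∀ {n} (u v : Fin n) {w} → transpose u v (transpose u v w) ≡ w
transpose-involutive u v {w} = trans (cong (transpose u v) (transpose-comm u v w)) (transpose-inverse u v)

transpose-injective : ∀ {n} (u v : Fin n) {w z} → transpose u v w ≡ transpose u v z → w ≡ z
transpose-injective u v eq =
  trans (sym (transpose-involutive u v)) (trans (cong (transpose u v) eq) (transpose-involutive u v))

-- Walks, and the permutation each one induces.

module Walks {n} (G : EdgeLabel n) where

  -- The product of the transpositions along the walk, first step first: a slot that held `w` holds
  -- `transport r w` once the stone has walked along `r`.
  transport : ∀ {u v} → Reach G u v → Fin n → Fin n
  transport here w = w
  transport (there {u} {v} _ r) w = transport r (transpose u v w)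

  transport-start : ∀ {u v} (r : Reach G u v) → transport r u ≡ v
  transport-start here = refl
  transport-start (there {u} {v} _ r) = trans (cong (transport r) (transpose-ˡ u v)) (transport-start r)

  transport-injective : ∀ {u v} (r : Reach G u v) {w z} → transport r w ≡ transport r z → w ≡ z
  transport-injective here eq = eq
  transport-injective (there {u} {v} _ r) eq = transpose-injective u v (transport-injective r eq)

  transport-surjective : ∀ {u v} (r : Reach G u v) y → ∃[ w ] transport r w ≡ y
  transport-surjective here y = y , refl
  transport-surjective (there {u} {v} _ r) y with transport-surjective r y
  ... | w , eq = transpose u v w , trans (cong (transport r) (transpose-involutive u v)) eq

  _▷_ : ∀ {u v w} → Reach G u v → Reach G v w → Reach G u w
  here ▷ s = s
  there a r ▷ s = there a (r ▷ s)

  transport-▷ : ∀ {u v w} (r : Reach G u v) (s : Reach G v w) z →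
                transport (r ▷ s) z ≡ transport s (transport r z)
  transport-▷ here s z = refl
  transport-▷ (there _ r) s z = transport-▷ r s _

  ▷-assoc : ∀ {u v w z} (r : Reach G u v) (s : Reach G v w) (t : Reach G w z) →
            (r ▷ s) ▷ t ≡ r ▷ (s ▷ t)
  ▷-assoc here        s t = refl
  ▷-assoc (there a r) s t = cong (there a) (▷-assoc r s t)

  data Path : Fin n → Fin n → List (Fin n) → Set where
    [_]  : ∀ v → Path v v []
    _∷_  : ∀ {u v b l} → Adj G u v → Path v b l → Path u b (v ∷ l)

  NonBacktracking : Fin n → List (Fin n) → Set
  NonBacktracking u []          = ⊤
  NonBacktracking u (v ∷ [])    = ⊤
  NonBacktracking u (v ∷ w ∷ l) = u ≢ w × NonBacktracking v (w ∷ l)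

  NonBacktracking-tail : ∀ u v l → NonBacktracking u (v ∷ l) → NonBacktracking v l
  NonBacktracking-tail u v []      _ = tt
  NonBacktracking-tail u v (w ∷ l) p = proj₂ p

  Path-adj : ∀ {u b l} → Path u b l → ∀ (j : Fin (length l)) →
             Adj G (lookup (u ∷ l) (Fin.inject₁ j)) (lookup l j)
  Path-adj (a ∷ p) Fin.zero    = a
  Path-adj (a ∷ p) (Fin.suc j) = Path-adj p j

  Path-last : ∀ {u b l} → Path u b l → lookup (u ∷ l) (Fin.fromℕ (length l)) ≡ b
  Path-last [ v ]   = refl
  Path-last (a ∷ p) = Path-last p

  Path-split : ∀ {u b z} l₁ {l₂} → Path u b (l₁ ++ z ∷ l₂) →
               ∃[ y ] Path u y l₁ × Adj G y z
  Path-split []       (a ∷ p) = _ , [ _ ] , a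
  Path-split (_ ∷ l₁) (a ∷ p) with Path-split l₁ p
  ... | y , q , a′ = y , a ∷ q , a′

  Path⇒Reach : ∀ {u b l} → Path u b l → Reach G u b
  Path⇒Reach [ _ ]   = here
  Path⇒Reach (a ∷ p) = there a (Path⇒Reach p)

-- Duplicate-free lists and the cyclic successor.

lookup-injective : ∀ {A : Set} {l : List A} → Unique l → ∀ j k → lookup l j ≡ lookup l k → j ≡ k
lookup-injective (_ ∷ _)  Fin.zero    Fin.zero    _  = refl
lookup-injective (a ∷ _)  Fin.zero    (Fin.suc k) eq = contradiction eq (All.lookup a (∈-lookup k))
lookup-injective (a ∷ _)  (Fin.suc j) Fin.zero    eq = contradiction (sym eq) (All.lookup a (∈-lookup j))
lookup-injective (_ ∷ u)  (Fin.suc j) (Fin.suc k) eq = cong Fin.suc (lookup-injective u j k eq)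

Unique-++ˡ : ∀ {A : Set} (l₁ : List A) {l₂} → Unique (l₁ ++ l₂) → Unique l₁
Unique-++ˡ []       _       = []
Unique-++ˡ (x ∷ l₁) (a ∷ u) = ++⁻ˡ l₁ a ∷ Unique-++ˡ l₁ u

Unique-middle : ∀ {A : Set} (l₁ : List A) {x l₂} → Unique (l₁ ++ x ∷ l₂) → All (x ≢_) l₁
Unique-middle []       _       = []
Unique-middle (y ∷ l₁) (a ∷ u) = (λ x≡y → All.head (++⁻ʳ l₁ a) (sym x≡y)) ∷ Unique-middle l₁ u

sucMod-inject₁ : ∀ {m} (j : Fin m) → sucMod (Fin.inject₁ j) ≡ Fin.suc j
sucMod-inject₁ {m} j = Fin.toℕ-injective (trans (Fin.toℕ-fromℕ< _)
  (trans (cong (λ k → suc k % suc m) (Fin.toℕ-inject₁ j)) (m<n⇒m%n≡m (s≤s (Fin.toℕ<n j)))))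

sucMod-fromℕ : ∀ m → sucMod (Fin.fromℕ m) ≡ Fin.zero
sucMod-fromℕ m = Fin.toℕ-injective (trans (Fin.toℕ-fromℕ< _)
  (trans (cong (λ k → suc k % suc m) (Fin.toℕ-fromℕ m)) (n%n≡0 (suc m))))

-- Separates the index at which `sucMod` wraps to zero from those at which it is the ordinary
-- successor.
data LastView {m} : Fin (suc m) → Set where
  isLast  : LastView (Fin.fromℕ m)
  notLast : ∀ j → LastView (Fin.inject₁ j)

lastView : ∀ {m} (j : Fin (suc m)) → LastView j
lastView {zero}  Fin.zero    = isLast
lastView {suc m} Fin.zero    = notLast Fin.zero
lastView {suc m} (Fin.suc j) with lastView j
... | isLast    = isLast
... | notLast k = notLast (Fin.suc k)

-- In a forest the transport depends only on the endpoints.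

module Forest {n} (G : EdgeLabel n) (simple : IsSimple G) (forest : IsForest G) where
  open Walks G

  Adj-sym : ∀ {u v} → Adj G u v → Adj G v u
  Adj-sym {u} {v} a eq = a (trans (proj₁ simple u v) eq)

  Adj-irrefl : ∀ {u v} → Adj G u v → u ≢ v
  Adj-irrefl {u} a refl = a (proj₂ simple u)

  reverse : ∀ {u v} → Reach G u v → Reach G v u
  reverse here = here
  reverse (there a r) = reverse r ▷ there (Adj-sym a) here

  closing-edge-absurd : ∀ {u y l} → Path u y l → Adj G y u → Unique (u ∷ l) → 2 ≤ length l → ⊥
  closing-edge-absurd {u} {y} {l} p a unique 2≤ = forest (suc (length l)) (lookup (u ∷ l))
    (s≤s 2≤ , (λ {j} {k} → lookup-injective unique j k) , adj)
    where
    adj : ∀ j → Adj G (lookup (u ∷ l) j) (lookup (u ∷ l) (sucMod j))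
    adj j with lastView j
    ... | isLast    = subst₂ (Adj G) (sym (Path-last p)) (sym (cong (lookup (u ∷ l)) (sucMod-fromℕ (length l)))) a
    ... | notLast k = subst (Adj G _) (sym (cong (lookup (u ∷ l)) (sucMod-inject₁ k))) (Path-adj p k)

  -- The tail is simple by induction. If `u` recurred in it, the segment before the recurrence would
  -- give a loop (empty), a backtrack (one vertex), or a cycle closed by the edge into `u` (two or
  -- more).
  NonBacktracking⇒Unique : ∀ {u b l} → Path u b l → NonBacktracking u l → Unique (u ∷ l)
  NonBacktracking⇒Unique {l = []} [ _ ] _ = [] ∷ []
  NonBacktracking⇒Unique {u} {l = v ∷ l} (a ∷ p) nb = ¬Any⇒All¬ _ u∉ ∷ unique
    where
    unique : Unique (v ∷ l)
    unique = NonBacktracking⇒Unique p (NonBacktracking-tail u v l nb)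

    u∉ : ¬ (u ∈ v ∷ l)
    u∉ u∈ with ∈-∃++ u∈
    ... | [] , l₂ , refl = Adj-irrefl a refl
    ... | _ ∷ [] , l₂ , refl = proj₁ nb refl
    ... | l₁@(_ ∷ _ ∷ _) , l₂ , eq with Path-split l₁ (subst (Path u _) eq (a ∷ p))
    ...   | _ , q , a′ = closing-edge-absurd q a′
            (Unique-middle l₁ (subst Unique eq unique) ∷ Unique-++ˡ l₁ (subst Unique eq unique)) (s≤s (s≤s z≤n))

  -- A step that backtracks undoes the last step of the path, so the steps of a walk can be pushed
  -- one at a time onto a non-backtracking path without changing the transport.
  reduce : ∀ {u v b l} (p : Path u b l) → NonBacktracking u l → (r : Reach G u v) →
           ∃[ l′ ] Σ[ q ∈ Path v b l′ ] NonBacktracking v l′ ×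
             (∀ w → transport (Path⇒Reach q) (transport r w) ≡ transport (Path⇒Reach p) w)
  reduce p nb here = _ , p , nb , λ _ → refl
  reduce {u} [ _ ] nb (there {v = v} a r) with reduce (Adj-sym a ∷ [ u ]) tt r
  ... | l′ , q , nb′ , eq = l′ , q , nb′ , λ w → trans (eq (transpose u v w)) (transpose-inverse v u)
  reduce {u} {l = t ∷ l} (a₀ ∷ p) nb (there {v = v} a r) with v ≟ t
  ... | yes refl with reduce p (NonBacktracking-tail u v l nb) r
  ...   | l′ , q , nb′ , eq = l′ , q , nb′ , λ w → eq (transpose u v w)
  reduce {u} {l = t ∷ l} (a₀ ∷ p) nb (there {v = v} a r) | no v≢t
    with reduce (Adj-sym a ∷ a₀ ∷ p) (v≢t , nb) r
  ...   | l′ , q , nb′ , eq = l′ , q , nb′ , λ w →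
          trans (eq (transpose u v w)) (cong (λ z → transport (Path⇒Reach p) (transpose u t z)) (transpose-inverse v u {w}))

  Path-end-∈ : ∀ {u b v l} → Path u b (v ∷ l) → b ∈ v ∷ l
  Path-end-∈ {l = []}    (_ ∷ [ _ ]) = here refl
  Path-end-∈ {l = _ ∷ _} (_ ∷ p)     = there (Path-end-∈ p)

  -- Reducing `r` against the empty path leaves a non-backtracking path from `u` to `u`. Such a path
  -- is simple, hence empty, and the empty path transports by the identity.
  transport-closed : ∀ {u} (r : Reach G u u) w → transport r w ≡ w
  transport-closed {u} r w with reduce [ u ] tt r
  ... | []    , [ _ ] , _  , eq = eq w
  ... | _ ∷ _ , q     , nb , _ with NonBacktracking⇒Unique q nb
  ...   | u∉ ∷ _ = contradiction refl (All.lookup u∉ (Path-end-∈ q))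

  -- Both `reverse r ▷ s` and `r ▷ reverse r` are closed, so the two bracketings of `r`,
  -- `reverse r`, `s` have the transports of `r` and of `s`.
  transport-unique : ∀ {u v} (r s : Reach G u v) w → transport r w ≡ transport s w
  transport-unique r s w = begin
    transport r w
      ≡⟨ transport-closed (reverse r ▷ s) (transport r w) ⟨
    transport (reverse r ▷ s) (transport r w)
      ≡⟨ transport-▷ r (reverse r ▷ s) w ⟨
    transport (r ▷ (reverse r ▷ s)) w
      ≡⟨ cong (λ t → transport t w) (▷-assoc r (reverse r) s) ⟨
    transport ((r ▷ reverse r) ▷ s) w
      ≡⟨ transport-▷ (r ▷ reverse r) s w ⟩
    transport s (transport (r ▷ reverse r) w)
      ≡⟨ cong (transport s) (transport-closed (r ▷ reverse r) w) ⟩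
    transport s w ∎
    where open ≡-Reasoning

-- Congruence of natural numbers.

infix 4 _≋_[mod_]
-- A record, so that `i` and `j` can be inferred from the type; they cannot be from an equation
-- between remainders.
record _≋_[mod_] (i j d : ℕ) .{{_ : NonZero d}} : Set where
  constructor congruent
  field remainders : i % d ≡ j % d
open _≋_[mod_]

module _ {d : ℕ} .{{_ : NonZero d}} where

  mod-refl : ∀ {i} → i ≋ i [mod d ]
  mod-refl = congruent refl

  mod-reflexive : ∀ {i j} → i ≡ j → i ≋ j [mod d ]
  mod-reflexive refl = congruent refl

  mod-sym : ∀ {i j} → i ≋ j [mod d ] → j ≋ i [mod d ]
  mod-sym (congruent eq) = congruent (sym eq)

  mod-trans : ∀ {i j k} → i ≋ j [mod d ] → j ≋ k [mod d ] → i ≋ k [mod d ]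
  mod-trans (congruent eq) (congruent eq′) = congruent (trans eq eq′)

  mod-+-multiple : ∀ i k → i + k * d ≋ i [mod d ]
  mod-+-multiple i k = congruent ([m+kn]%n≡m%n i k d)

  mod-% : ∀ i → i % d ≋ i [mod d ]
  mod-% i = congruent (m%n%n≡m%n i d)

  mod-+-cong : ∀ {i i′ j j′} → i ≋ i′ [mod d ] → j ≋ j′ [mod d ] → i + j ≋ i′ + j′ [mod d ]
  mod-+-cong {i} {i′} {j} {j′} (congruent eq) (congruent eq′) = congruent (begin
    (i + j) % d            ≡⟨ %-distribˡ-+ i j d ⟩
    (i % d + j % d) % d    ≡⟨ cong₂ (λ u v → (u + v) % d) eq eq′ ⟩
    (i′ % d + j′ % d) % d  ≡⟨ %-distribˡ-+ i′ j′ d ⟨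
    (i′ + j′) % d          ∎)
    where open ≡-Reasoning

  mod-*-cong : ∀ {i i′ j j′} → i ≋ i′ [mod d ] → j ≋ j′ [mod d ] → i * j ≋ i′ * j′ [mod d ]
  mod-*-cong {i} {i′} {j} {j′} (congruent eq) (congruent eq′) = congruent (begin
    (i * j) % d                ≡⟨ %-distribˡ-* i j d ⟩
    ((i % d) * (j % d)) % d    ≡⟨ cong₂ (λ u v → (u * v) % d) eq eq′ ⟩
    ((i′ % d) * (j′ % d)) % d  ≡⟨ %-distribˡ-* i′ j′ d ⟨
    (i′ * j′) % d              ∎)
    where open ≡-Reasoning

mod-+-cancelʳ : ∀ {d} .{{_ : NonZero d}} i j k → i + k ≋ j + k [mod d ] → i ≋ j [mod d ]
mod-+-cancelʳ {suc d} i j k eq =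
  mod-trans (mod-sym (absorb i)) (mod-trans (mod-+-cong eq mod-refl) (absorb j))
  where
  -- Adding `k * d` subtracts `k` modulo `suc d`.
  shuffle : ∀ i k d → i + k + k * d ≡ i + k * suc d
  shuffle = solve-∀
  absorb : ∀ i → i + k + k * d ≋ i [mod suc d ]
  absorb i = mod-trans (mod-reflexive (shuffle i k d)) (mod-+-multiple i k)

mod-+-cancelˡ : ∀ {d} .{{_ : NonZero d}} k i j → k + i ≋ k + j [mod d ] → i ≋ j [mod d ]
mod-+-cancelˡ k i j eq = mod-+-cancelʳ i j k
  (mod-trans (mod-reflexive (ℕ.+-comm i k)) (mod-trans eq (mod-reflexive (ℕ.+-comm k j))))

-- Searching for the first time and for a change of a decidable predicate.

least : ∀ {Q : ℕ → Set} → Decidable Q → ∀ k → Q k → ∃[ l ] Q l × (∀ j → j < l → ¬ Q j)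
least Q? k q with Q? 0
least Q? k       q | yes q₀ = 0 , q₀ , λ _ ()
least Q? zero    q | no ¬q₀ = contradiction q ¬q₀
least Q? (suc k) q | no ¬q₀ with least (Q? ∘ suc) k q
... | l , ql , below = suc l , ql , λ where
  zero    _         → ¬q₀
  (suc j) (s≤s j<l) → below j j<l

module _ {Q : ℕ → Set} (Q? : Decidable Q) where

  switch : ∀ s k → Q s → ¬ Q (s + k) → ∃[ t ] Q t × ¬ Q (suc t)
  switch s zero    q ¬q = contradiction (subst Q (sym (ℕ.+-identityʳ s)) q) ¬q
  switch s (suc k) q ¬q with Q? (suc s)
  ... | yes q′ = switch (suc s) k q′ (¬q ∘ subst Q (sym (ℕ.+-suc s k)))
  ... | no ¬q′ = s , q , ¬q′

-- Crossing an edge; sums over a product of lists.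

cross : ∀ {n} → EdgeType → Fin n → Fin n → Fin n
cross nonEdge  x y = x
cross reflEdge x y = y
cross refrEdge x y = y

cross-nonEdge : ∀ {n} {t} {x y : Fin n} → t ≡ nonEdge → cross t x y ≡ x
cross-nonEdge refl = refl

cross-edge : ∀ {n} {t} {x y : Fin n} → t ≢ nonEdge → cross t x y ≡ y
cross-edge {t = nonEdge}  t≢ = contradiction refl t≢
cross-edge {t = reflEdge} t≢ = refl
cross-edge {t = refrEdge} t≢ = refl

nonEdge? : ∀ t → Dec (t ≡ nonEdge)
nonEdge? nonEdge  = yes refl
nonEdge? reflEdge = no λ ()
nonEdge? refrEdge = no λ ()

length-cartesianProduct : ∀ {A B : Set} (xs : List A) (ys : List B) →
                          length (cartesianProduct xs ys) ≡ length xs * length ys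
length-cartesianProduct []       ys = refl
length-cartesianProduct (x ∷ xs) ys = trans (length-++ (map (x ,_) ys))
  (cong₂ _+_ (length-map (x ,_) ys) (length-cartesianProduct xs ys))

sum-map-const : ∀ {A : Set} k (xs : List A) → sum (map (λ _ → k) xs) ≡ length xs * k
sum-map-const k []       = refl
sum-map-const k (_ ∷ xs) = cong (k +_) (sum-map-const k xs)

sum-cartesianProduct : ∀ {A B : Set} (f : A → ℕ) (xs : List A) (ys : List B) →
                       sum (map (f ∘ proj₁) (cartesianProduct xs ys)) ≡ length ys * sum (map f xs)
sum-cartesianProduct f []       ys = sym (ℕ.*-zeroʳ (length ys))
sum-cartesianProduct f (x ∷ xs) ys = begin
  sum (map (f ∘ proj₁) (map (x ,_) ys ++ cartesianProduct xs ys))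
    ≡⟨ cong sum (map-++ (f ∘ proj₁) (map (x ,_) ys) _) ⟩
  sum (map (f ∘ proj₁) (map (x ,_) ys) ++ map (f ∘ proj₁) (cartesianProduct xs ys))
    ≡⟨ sum-++ (map (f ∘ proj₁) (map (x ,_) ys)) _ ⟩
  sum (map (f ∘ proj₁) (map (x ,_) ys)) + sum (map (f ∘ proj₁) (cartesianProduct xs ys))
    ≡⟨ cong₂ _+_ (trans (cong sum (sym (map-∘ ys))) (sum-map-const (f x) ys)) (sum-cartesianProduct f xs ys) ⟩
  length ys * f x + length ys * sum (map f xs)
    ≡⟨ ℕ.*-distribˡ-+ (length ys) (f x) _ ⟨
  length ys * sum (map f (x ∷ xs)) ∎
  where open ≡-Reasoning

-- The configuration relative to the stone.

-- Seen from the stone, which starts at x₀, the other vertices fill m = n − 1 cyclic slots, and a j is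
-- the vertex initially in slot j. An edge always occupies the same slot, so that the stone swaps
-- with the occupant y of a slot by applying the transposition (stone y) to all occupants. Hence
-- P v (a j) is the occupant of slot j whenever the stone is v. The weight e v represents ± 1.
record Unfolding {n} (G : EdgeLabel n) (x₀ : Fin n) (m : ℕ) .{{_ : NonZero m}} : Set where
  open Walks G
  field
    Adj-sym      : ∀ {u v} → Adj G u v → Adj G v u
    Adj-irrefl   : ∀ {u v} → Adj G u v → u ≢ v
    P            : Fin n → Fin n → Fin n
    P-transport  : ∀ {v} (r : Reach G x₀ v) w → P v w ≡ transport r w
    a            : ℕ → Fin n
    a-cong       : ∀ {i j} → i ≋ j [mod m ] → a i ≡ a j
    a-injective  : ∀ {i j} → a i ≡ a j → i ≋ j [mod m ]
    a≢x₀         : ∀ i → a i ≢ x₀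
    a-surjective : ∀ {w} → w ≢ x₀ → ∃[ i ] a i ≡ w
    e            : Fin n → ℕ
    e²≡1         : ∀ v → e v * e v ≋ 1 [mod m ]
    i₀           : ℕ

  T : Fin n → Set
  T = Reach G x₀

  _∷ʳ_ : ∀ {u v} → T u → Adj G u v → T v
  r ∷ʳ adj = r ▷ there adj here

  P-start : ∀ {u} → T u → P u x₀ ≡ u
  P-start r = trans (P-transport r x₀) (transport-start r)

  P-step : ∀ {u v} → T u → Adj G u v → ∀ w → P v w ≡ transpose u v (P u w)
  P-step {u} {v} r adj w = begin
    P v w                          ≡⟨ P-transport (r ∷ʳ adj) w ⟩
    transport (r ∷ʳ adj) w         ≡⟨ transport-▷ r (there adj here) w ⟩
    transpose u v (transport r w)  ≡⟨ cong (transpose u v) (P-transport r w) ⟨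
    transpose u v (P u w)          ∎
    where open ≡-Reasoning

  P-injective : ∀ {u} → T u → ∀ {w z} → P u w ≡ P u z → w ≡ z
  P-injective r {w} {z} eq =
    transport-injective r (trans (sym (P-transport r w)) (trans eq (P-transport r z)))

  P-surjective : ∀ {u} → T u → ∀ y → ∃[ w ] P u w ≡ y
  P-surjective r y with transport-surjective r y
  ... | w , eq = w , trans (P-transport r w) eq

  P≢stone : ∀ {u} i → T u → P u (a i) ≢ u
  P≢stone i r eq = a≢x₀ i (P-injective r (trans eq (sym (P-start r))))

-- The lifted dynamics and its reversibility.

module Tour {n} {G : EdgeLabel n} {x₀ : Fin n} {m : ℕ} .{{_ : NonZero m}} (U : Unfolding G x₀ m) where
  open Unfolding U

  ahead : ℕ → Fin n → Fin n
  ahead i x = P x (a i)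

  κ : ℕ → Fin n → Fin n
  κ i x = cross (G x (ahead i x)) x (ahead i x)

  Φ : Fin n × ℕ → Fin n × ℕ
  Φ (x , i) = κ i x , i + e (κ i x)

  x : ℕ → Fin n
  x t = proj₁ (iterate Φ t (x₀ , i₀))

  p : ℕ → ℕ
  p t = proj₂ (iterate Φ t (x₀ , i₀))

  ahead-cong : ∀ {i j} v → i ≋ j [mod m ] → ahead i v ≡ ahead j v
  ahead-cong v eq = cong (P v) (a-cong eq)

  κ-cong : ∀ {i j} v → i ≋ j [mod m ] → κ i v ≡ κ j v
  κ-cong v eq = cong (λ y → cross (G v y) v y) (ahead-cong v eq)

  κ-T : ∀ {v} i → T v → T (κ i v)
  κ-T {v} i r with nonEdge? (G v (ahead i v))
  ... | yes eq = subst T (sym (cross-nonEdge eq)) r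
  ... | no adj = subst T (sym (cross-edge adj)) (r ∷ʳ adj)

  T-x : ∀ t → T (x t)
  T-x zero    = here
  T-x (suc t) = κ-T (p t) (T-x t)

  ahead-cross : ∀ {v} i → T v → Adj G v (ahead i v) → ahead i (ahead i v) ≡ v
  ahead-cross {v} i r adj = trans (P-step r adj (a i)) (transpose-ʳ v (ahead i v))

  -- After a crossing the slot holds the previous stone, and the same edge leads back to it.
  κ-involutive : ∀ {v} i → T v → κ i (κ i v) ≡ v
  κ-involutive {v} i r with nonEdge? (G v (ahead i v))
  ... | yes eq = trans (cong (κ i) κv≡v) κv≡v
    where
    κv≡v : κ i v ≡ v
    κv≡v = cross-nonEdge eq
  ... | no adj = trans (cong (κ i) (cross-edge adj)) (trans (cross-edge back) y≡v)
    where
    y≡v : ahead i (ahead i v) ≡ v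
    y≡v = ahead-cross i r adj
    back : Adj G (ahead i v) (ahead i (ahead i v))
    back = subst (Adj G (ahead i v)) (sym y≡v) (Adj-sym adj)

  -- The step just made is `e` of the new stone, so the old slot is known modulo `m`; applying `κ`
  -- at that slot again recovers the old stone.
  Φ-injective : ∀ {u v i j} → T u → T v → proj₁ (Φ (u , i)) ≡ proj₁ (Φ (v , j)) →
                proj₂ (Φ (u , i)) ≋ proj₂ (Φ (v , j)) [mod m ] → u ≡ v × i ≋ j [mod m ]
  Φ-injective {u} {v} {i} {j} ru rv κ≡ p≡ = u≡v , i≡j
    where
    i≡j : i ≋ j [mod m ]
    i≡j = mod-+-cancelʳ i j (e (κ j v)) (mod-trans (mod-reflexive (cong (λ z → i + e z) (sym κ≡))) p≡)
    u≡v : u ≡ v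
    u≡v = begin
      u            ≡⟨ κ-involutive i ru ⟨
      κ i (κ i u)  ≡⟨ cong (κ i) κ≡ ⟩
      κ i (κ j v)  ≡⟨ κ-cong (κ j v) i≡j ⟩
      κ j (κ j v)  ≡⟨ κ-involutive j rv ⟩
      v            ∎
      where open ≡-Reasoning

  -- The first return modulo `m`, and laps.

  Return : ℕ → Set
  Return t = x t ≡ x₀ × p t ≋ i₀ [mod m ]

  return? : Decidable Return
  return? t with x t ≟ x₀ | p t % m ℕ.≟ i₀ % m
  ... | yes x≡ | yes p≡ = yes (x≡ , congruent p≡)
  ... | yes _  | no ¬p≡ = no λ (_ , p≡) → ¬p≡ (remainders p≡)
  ... | no ¬x≡ | _      = no λ (x≡ , _) → ¬x≡ x≡

  recurrence⇒Return : ∀ s k → x (s + k) ≡ x s → p (s + k) ≋ p s [mod m ] → Return k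
  recurrence⇒Return zero    k x≡ p≡ = x≡ , p≡
  recurrence⇒Return (suc s) k x≡ p≡ with Φ-injective (T-x (s + k)) (T-x s) x≡ p≡
  ... | x≡′ , p≡′ = recurrence⇒Return s k x≡′ p≡′

  private
    state : ℕ → Fin (n * m)
    state t = Fin.combine (x t) (p t mod m)

  -- There are only `n * m` states modulo `m`, so two times share a state; injectivity of `Φ` pulls
  -- this coincidence back to time 0.
  someReturn : ∃[ k ] Return (suc k)
  someReturn with Fin.pigeonhole (ℕ.n<1+n (n * m)) (state ∘ toℕ)
  ... | s , t , s<t , eq with ℕ.m≤n⇒∃[o]m+o≡n s<t
  ...   | k , s+k≡t with Fin.combine-injective (x (toℕ s)) (p (toℕ s) mod m) (x (toℕ t)) (p (toℕ t) mod m) eq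
  ...     | x≡ , p≡ = k , recurrence⇒Return (toℕ s) (suc k)
              (trans (cong x s+1+k≡t) (sym x≡)) (mod-trans (mod-reflexive (cong p s+1+k≡t)) (congruent (sym p≡′)))
    where
    s+1+k≡t = trans (ℕ.+-suc (toℕ s) k) s+k≡t
    p≡′ : p (toℕ s) % m ≡ p (toℕ t) % m
    p≡′ = trans (sym (Fin.toℕ-fromℕ< _)) (trans (cong toℕ p≡) (Fin.toℕ-fromℕ< _))

  abstract
    firstReturn : ∃[ k ] Return (suc k) × (∀ j → j < k → ¬ Return (suc j))
    firstReturn = least (return? ∘ suc) (proj₁ someReturn) (proj₂ someReturn)

  K : ℕ
  K = suc (proj₁ firstReturn)

  K-return : Return K
  K-return = proj₁ (proj₂ firstReturn)

  K-first : ∀ {t} → 0 < t → t < K → ¬ Return t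
  K-first {suc t} _ (s≤s t<K) = proj₂ (proj₂ firstReturn) t t<K

  -- The displacement of the lifted index over one lap. It vanishes modulo `m`; its residue modulo
  -- `n` decides which laps end in an exact return.
  drift : ℕ
  drift = sum (applyDownFrom (λ t → e (x (suc t))) K)

  p-sum : ∀ t → p t ≡ i₀ + sum (applyDownFrom (λ s → e (x (suc s))) t)
  p-sum zero    = sym (ℕ.+-identityʳ i₀)
  p-sum (suc t) = trans (cong (_+ e (x (suc t))) (p-sum t)) (shuffle i₀ _ _)
    where
    shuffle : ∀ i s d → i + s + d ≡ i + (d + s)
    shuffle = solve-∀

  drift≋0 : drift ≋ 0 [mod m ]
  drift≋0 = mod-+-cancelˡ i₀ drift 0 (mod-trans (mod-reflexive (sym (p-sum K)))
    (mod-trans (proj₂ K-return) (mod-reflexive (sym (ℕ.+-identityʳ i₀)))))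

  mod-+-drift : ∀ i → i + drift ≋ i [mod m ]
  mod-+-drift i = mod-trans (mod-+-cong (mod-refl {i = i}) drift≋0) (mod-reflexive (ℕ.+-identityʳ i))

  -- `κ` sees the index only modulo `m`, where `drift` vanishes, so the next lap repeats the same
  -- stones.
  after-K : ∀ t → x (t + K) ≡ x t × p (t + K) ≡ p t + drift
  after-K zero    = proj₁ K-return , p-sum K
  after-K (suc t) = x≡ , (begin
    p (t + K) + e (x (suc t + K))    ≡⟨ cong₂ _+_ (proj₂ (after-K t)) (cong e x≡) ⟩
    p t + drift + e (x (suc t))      ≡⟨ shuffle (p t) drift _ ⟩
    p t + e (x (suc t)) + drift      ∎)
    where
    open ≡-Reasoning
    shuffle : ∀ i s d → i + s + d ≡ i + d + s
    shuffle = solve-∀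
    x≡ : κ (p (t + K)) (x (t + K)) ≡ κ (p t) (x t)
    x≡ = begin
      κ (p (t + K)) (x (t + K))  ≡⟨ cong₂ κ (proj₂ (after-K t)) (proj₁ (after-K t)) ⟩
      κ (p t + drift) (x t)      ≡⟨ κ-cong (x t) (mod-+-drift (p t)) ⟩
      κ (p t) (x t)              ∎

  after-rK : ∀ r t → x (t + r * K) ≡ x t × p (t + r * K) ≡ p t + r * drift
  after-rK zero    t = cong x (ℕ.+-identityʳ t) , trans (cong p (ℕ.+-identityʳ t)) (sym (ℕ.+-identityʳ (p t)))
  after-rK (suc r) t =
      trans (cong x lap) (trans (proj₁ (after-K (t + r * K))) (proj₁ (after-rK r t)))
    , trans (cong p lap) (trans (proj₂ (after-K (t + r * K))) (trans (cong (_+ drift) (proj₂ (after-rK r t)))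
        (sym (shuffle (p t) drift (r * drift)))))
    where
    shuffle : ∀ i s d → i + (s + d) ≡ i + d + s
    shuffle = solve-∀
    lap : t + suc r * K ≡ t + r * K + K
    lap = shuffle t K (r * K)

  mod-+-drifts : ∀ i r → i + r * drift ≋ i [mod m ]
  mod-+-drifts i r = mod-trans (mod-+-cong (mod-refl {i = i}) (mod-*-cong (mod-refl {i = r}) drift≋0))
    (mod-reflexive (trans (cong (i +_) (ℕ.*-zeroʳ r)) (ℕ.+-identityʳ i)))

  after-rK-mod : ∀ r t → x (t + r * K) ≡ x t × p (t + r * K) ≋ p t [mod m ]
  after-rK-mod r t = proj₁ (after-rK r t) ,
    mod-trans (mod-reflexive (proj₂ (after-rK r t))) (mod-+-drifts (p t) r)

  -- Removing whole laps from `t` leaves a return at time `t % K`, which is before the first return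
  -- unless it is 0.
  Return⇒K∣ : ∀ {t} → Return t → K ∣ t
  Return⇒K∣ {t} (x≡ , p≡) with t % K | m%n<n t K | m≡m%n+[m/n]*n t K
  ... | zero  | _   | t≡ = divides (t / K) t≡
  ... | suc s | s<K | t≡ = contradiction
    ( trans (sym (proj₁ (after-rK-mod (t / K) (suc s)))) (trans (cong x (sym t≡)) x≡)
    , mod-trans (mod-sym (proj₂ (after-rK-mod (t / K) (suc s)))) (mod-trans (mod-reflexive (cong p (sym t≡))) p≡))
    (K-first (s≤s z≤n) s<K)

  -- Every state of the component is visited.

  Visited : Fin n → ℕ → Set
  Visited v i = ∃[ t ] x t ≡ v × p t ≋ i [mod m ]

  -- Once the tour leaves u = x t through the edge to y, the occupant P v (a i) of the slot just
  -- crossed is u until the tour steps back to u, and it can only do so from y.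
  visited-return : ∀ t → Adj G (x t) (ahead (p t) (x t)) → Visited (ahead (p t) (x t)) (p t)
  visited-return t adj = comeback (switch (λ s → P (x s) w ≟ u) (suc t) (proj₁ firstReturn) leaves returns)
    where
    u = x t
    w = a (p t)
    y = P u w

    x-suc : x (suc t) ≡ y
    x-suc = cross-edge adj

    leaves : P (x (suc t)) w ≡ u
    leaves = trans (cong (λ v → P v w) x-suc) (ahead-cross (p t) (T-x t) adj)

    -- One lap after `t` the stone is `u` again, and no slot holds the stone.
    returns : P (x (suc t + proj₁ firstReturn)) w ≢ u
    returns eq = P≢stone (p t) (T-x t) (trans (cong (λ v → P v w) (sym x≡)) eq)
      where
      x≡ : x (suc t + proj₁ firstReturn) ≡ u
      x≡ = trans (cong x (sym (ℕ.+-suc t _))) (proj₁ (after-K t))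

    comeback : ∃[ s ] P (x s) w ≡ u × P (x (suc s)) w ≢ u → Visited y (p t)
    comeback (s , before , after) with nonEdge? (G (x s) (ahead (p s) (x s)))
    ... | yes eq = contradiction (trans (cong (λ v → P v w) (cross-nonEdge eq)) before) after
    ... | no adj′ = s , xs≡y , a-injective (P-injective (T-x s) (trans v≡u (sym before)))
      where
      z = x s
      v = ahead (p s) z
      x-suc′ : x (suc s) ≡ v
      x-suc′ = cross-edge adj′
      z≢u : u ≢ z
      z≢u u≡z = P≢stone (p t) (T-x s) (trans before u≡z)
      Pv : P v w ≡ transpose z v u
      Pv = trans (P-step (T-x s) adj′ w) (cong (transpose z v) before)
      -- A step to any other vertex would be a transposition fixing `u`, leaving `u` in the slot.
      v≡u : v ≡ u
      v≡u with u ≟ v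
      ... | yes u≡v = sym u≡v
      ... | no u≢v = contradiction
        (trans (cong (λ v → P v w) x-suc′) (trans Pv (transpose-≢ z≢u u≢v))) after
      -- The step back leaves `z` in the slot; but occupants depend only on the stone, and with
      -- stone `u` this slot holds `y`.
      xs≡y : z ≡ y
      xs≡y = begin
        z                ≡⟨ transpose-ʳ z u ⟨
        transpose z u u  ≡⟨ cong (λ v → transpose z v u) v≡u ⟨
        transpose z v u  ≡⟨ Pv ⟨
        P v w            ≡⟨ cong (λ v → P v w) v≡u ⟩
        y                ∎
        where open ≡-Reasoning

  visited-ahead : ∀ {v i} → Visited v i → Adj G v (ahead i v) → Visited (ahead i v) i
  visited-ahead {v} (t , refl , p≡) adj =
    let y≡ = ahead-cong v p≡
        (t′ , x≡ , p≡′) = visited-return t (subst (Adj G v) (sym y≡) adj)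
    in t′ , trans x≡ y≡ , mod-trans p≡′ p≡

  visited-κ : ∀ {v i} → Visited v i → Visited (κ i v) i
  visited-κ {v} {i} vis with nonEdge? (G v (ahead i v))
  ... | yes eq = subst (λ v → Visited v i) (sym (cross-nonEdge eq)) vis
  ... | no adj = subst (λ v → Visited v i) (sym (cross-edge adj)) (visited-ahead vis adj)

  visited-T : ∀ {v i} → Visited v i → T v
  visited-T (t , refl , _) = T-x t

  -- From the visited state `(κ i v , i)` the next step restores `v`, as `κ i` is an involution, and
  -- then moves on by `e v`.
  visited-+e : ∀ {v i} → Visited v i → Visited v (i + e v)
  visited-+e {v} {i} vis with visited-κ vis
  ... | t , x≡ , p≡ = suc t , x≡′ , mod-+-cong p≡ (mod-reflexive (cong e x≡′))
    where
    x≡′ : κ (p t) (x t) ≡ v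
    x≡′ = trans (κ-cong (x t) p≡) (trans (cong (κ i) x≡) (κ-involutive i (visited-T vis)))

  visited-+ke : ∀ k {v i} → Visited v i → Visited v (i + k * e v)
  visited-+ke zero    vis = subst (Visited _) (sym (ℕ.+-identityʳ _)) vis
  visited-+ke (suc k) {v} {i} vis = subst (Visited v) (shuffle i (e v) (k * e v)) (visited-+e (visited-+ke k vis))
    where
    shuffle : ∀ i d s → i + s + d ≡ i + (d + s)
    shuffle = solve-∀

  visited-cong : ∀ {v i j} → i ≋ j [mod m ] → Visited v i → Visited v j
  visited-cong eq (t , x≡ , p≡) = t , x≡ , mod-trans p≡ eq

  visited-everywhere : ∀ {v i} → Visited v i → ∀ j → Visited v j
  visited-everywhere {v} {i} vis j = visited-cong to-j (visited-+ke (d * e v) vis)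
    where
    -- This is `j − i` modulo `m`. Since `e v` is its own inverse there, `d * e v` moves of size
    -- `e v` lead from `i` to `j`.
    d = j + i * pred m
    to-j : i + d * e v * e v ≋ j [mod m ]
    to-j = mod-trans (mod-reflexive (cong (i +_) (ℕ.*-assoc d (e v) (e v))))
      (mod-trans (mod-+-cong (mod-refl {i = i}) (mod-*-cong (mod-refl {i = d}) (e²≡1 v)))
      (mod-trans (mod-reflexive (trans (shuffle i j (pred m)) (cong (λ m → j + i * m) (ℕ.suc-pred m))))
      (mod-+-multiple j i)))
      where
      shuffle : ∀ i j l → i + (j + i * l) * 1 ≡ j + i * suc l
      shuffle = solve-∀

  -- Seen from `u`, a neighbour `v` occupies some slot `i`; as `u` is visited at `i`, so is `v`, and
  -- then `v` is visited at every slot.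
  all-visited : ∀ {u v} → Reach G u v → T u → (∀ j → Visited u j) → ∀ j → Visited v j
  all-visited here _ vis = vis
  all-visited (there {u} {v} adj r) ru vis = all-visited r (ru ∷ʳ adj) (visited-everywhere v-visited)
    where
    slot : ∃[ i ] ahead i u ≡ v
    slot with P-surjective ru v
    ... | w , Pw≡v with a-surjective {w} (λ w≡x₀ → P-irrefl (trans (sym (P-start ru)) (trans (cong (P u) (sym w≡x₀)) Pw≡v)))
      where
      P-irrefl : u ≢ v
      P-irrefl = Adj-irrefl adj
    ...   | i , ai≡w = i , trans (cong (P u) ai≡w) Pw≡v
    i = proj₁ slot
    v-visited : Visited v i
    v-visited = subst (λ y → Visited y i) (proj₂ slot)
      (visited-ahead (vis i) (subst (Adj G u) (sym (proj₂ slot)) adj))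

  all-states-visited : ∀ {v} → T v → ∀ j → Visited v j
  all-states-visited r = all-visited r here (visited-everywhere (0 , refl , mod-refl))

  -- Counting the states of one lap.

  state-at : ℕ → Fin n × Fin m
  state-at t = x (suc t) , p (suc t) mod m

  module _ {L : List (Fin n)} (unique : Unique L) (∈L⇒T : ∀ {v} → v ∈ L → T v) (T⇒∈L : ∀ {v} → T v → v ∈ L) where

    states-unique : Unique (applyDownFrom state-at K)
    states-unique = applyDownFrom⁺₁ state-at K distinct
      where
      distinct : ∀ {i j} → j < i → i < K → state-at i ≢ state-at j
      distinct {i} {j} j<i i<K eq with ℕ.m≤n⇒∃[o]m+o≡n j<i
      ... | k , refl = K-first (s≤s z≤n) k<K (recurrence⇒Return (suc j) (suc k) x≡ p≡)
        where
        1+k : suc (suc j + k) ≡ suc j + suc k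
        1+k = sym (ℕ.+-suc (suc j) k)
        k<K : suc k < K
        k<K = ℕ.≤-<-trans (s≤s (ℕ.m≤n+m k j)) i<K
        x≡ : x (suc j + suc k) ≡ x (suc j)
        x≡ = trans (cong x (sym 1+k)) (cong proj₁ eq)
        p≡ : p (suc j + suc k) ≋ p (suc j) [mod m ]
        p≡ = mod-trans (mod-reflexive (cong p (sym 1+k)))
          (congruent (trans (sym (Fin.toℕ-fromℕ< _)) (trans (cong (toℕ ∘ proj₂) eq) (Fin.toℕ-fromℕ< _))))

    -- A repetition within the lap would be a return before `K`. Conversely every state is visited
    -- at some time, which laps reduce to one of the times 1 to `K`.
    states↭ : applyDownFrom state-at K ↭ cartesianProduct L (allFin m)
    states↭ = ∼bag⇒↭ (unique∧set⇒bag states-unique (cartesianProduct⁺ unique (allFin⁺ m)) (mk⇔ to from))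
      where
      to : ∀ {vj} → vj ∈ applyDownFrom state-at K → vj ∈ cartesianProduct L (allFin m)
      to vj∈ with ∈-applyDownFrom⁻ state-at vj∈
      ... | t , _ , refl = ∈-cartesianProduct⁺ (T⇒∈L (T-x (suc t))) (∈-allFin _)

      from : ∀ {vj} → vj ∈ cartesianProduct L (allFin m) → vj ∈ applyDownFrom state-at K
      from {v , j} vj∈ with all-states-visited (∈L⇒T (proj₁ (∈-cartesianProduct⁻ L (allFin m) vj∈))) (toℕ j)
      ... | t , x≡ , p≡ = subst (_∈ applyDownFrom state-at K) state≡ (∈-applyDownFrom⁺ state-at (m%n<n t⁻ K))
        where
        -- This is `t − 1` plus one lap: `state-at` records the state after the step, so the state
        -- at time `t` has index `t − 1` modulo `K`.
        t⁻ = t + proj₁ firstReturn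
        s = t⁻ % K
        lap : suc s + t⁻ / K * K ≡ t + 1 * K
        lap = trans (cong suc (sym (m≡m%n+[m/n]*n t⁻ K))) (trans (sym (ℕ.+-suc t _)) (cong (t +_) (sym (ℕ.+-identityʳ K))))
        x≡s : x (suc s) ≡ v
        x≡s = trans (sym (proj₁ (after-rK-mod (t⁻ / K) (suc s))))
          (trans (cong x lap) (trans (proj₁ (after-rK-mod 1 t)) x≡))
        p≡s : p (suc s) ≋ toℕ j [mod m ]
        p≡s = mod-trans (mod-sym (proj₂ (after-rK-mod (t⁻ / K) (suc s))))
          (mod-trans (mod-reflexive (cong p lap)) (mod-trans (proj₂ (after-rK-mod 1 t)) p≡))
        state≡ : state-at s ≡ (v , j)
        state≡ = cong₂ _,_ x≡s (Fin.toℕ-injective (trans (Fin.toℕ-fromℕ< _)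
          (trans (remainders p≡s) (m<n⇒m%n≡m (Fin.toℕ<n j)))))

    K≡ : K ≡ length L * m
    K≡ = trans (sym (length-applyDownFrom state-at K)) (trans (↭-length states↭)
      (trans (length-cartesianProduct L (allFin m)) (cong (length L *_) (length-tabulate (λ i → i)))))

    -- Each step adds the weight of the stone it ends with, and over a lap each vertex of the
    -- component is that stone once for every residue modulo `m`.
    drift≡ : drift ≡ m * sum (map e L)
    drift≡ = begin
      sum (applyDownFrom (λ t → e (x (suc t))) K)
        ≡⟨ cong sum (map-applyDownFrom state-at (e ∘ proj₁) K) ⟨
      sum (map (e ∘ proj₁) (applyDownFrom state-at K))
        ≡⟨ sum-↭ (↭-map⁺ (e ∘ proj₁) states↭) ⟩
      sum (map (e ∘ proj₁) (cartesianProduct L (allFin m)))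
        ≡⟨ sum-cartesianProduct e L (allFin m) ⟩
      length (allFin m) * sum (map e L)
        ≡⟨ cong (_* sum (map e L)) (length-tabulate {n = m} (λ i → i)) ⟩
      m * sum (map e L) ∎
      where open ≡-Reasoning

-- Congruence and divisibility; residues as elements of `Fin`.

¬mod-0 : ∀ {d k} .{{_ : NonZero d}} → 0 < k → k < d → ¬ (k ≋ 0 [mod d ])
¬mod-0 {suc d} {suc k} _ k<d (congruent eq) with trans (sym (m<n⇒m%n≡m k<d)) eq
... | ()

¬mod-+ : ∀ {d} .{{_ : NonZero d}} k i → 0 < k → k < d → ¬ (k + i ≋ i [mod d ])
¬mod-+ k i 0<k k<d eq = ¬mod-0 0<k k<d (mod-+-cancelʳ k 0 i eq)

≋0⇒∣ : ∀ {d k} .{{_ : NonZero d}} → k ≋ 0 [mod d ] → d ∣ k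
≋0⇒∣ {suc d} {k} (congruent eq) = m%n≡0⇒n∣m k (suc d) eq

∣⇒≋0 : ∀ {d k} .{{_ : NonZero d}} → d ∣ k → k ≋ 0 [mod d ]
∣⇒≋0 {d} (divides q refl) = mod-+-multiple 0 q

≋⇒∣ : ∀ {d} .{{_ : NonZero d}} i j → i ≋ j [mod d ] → d ∣ ∣ i - j ∣
≋⇒∣ {d} i j eq = by-order (ℕ.≤-total i j)
  where
  ordered : ∀ {i j} → i ≤ j → i ≋ j [mod d ] → d ∣ ∣ i - j ∣
  ordered {i} i≤j eq with k , refl ← ℕ.m≤n⇒∃[o]m+o≡n i≤j = subst (d ∣_) (sym (ℕ.∣m-m+n∣≡n i k))
    (≋0⇒∣ (mod-+-cancelˡ i k 0 (mod-trans (mod-sym eq) (mod-reflexive (sym (ℕ.+-identityʳ i))))))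
  by-order : i ≤ j ⊎ j ≤ i → d ∣ ∣ i - j ∣
  by-order (inj₁ i≤j) = ordered i≤j eq
  by-order (inj₂ j≤i) = subst (d ∣_) (ℕ.∣-∣-comm j i) (ordered j≤i (mod-sym eq))

∣⇒≋ : ∀ {d} .{{_ : NonZero d}} i j → d ∣ ∣ i - j ∣ → i ≋ j [mod d ]
∣⇒≋ {d} i j d∣ = by-order (ℕ.≤-total i j)
  where
  ordered : ∀ {i j} → i ≤ j → d ∣ ∣ i - j ∣ → j ≋ i [mod d ]
  ordered {i} i≤j d∣ with k , refl ← ℕ.m≤n⇒∃[o]m+o≡n i≤j = mod-trans
    (mod-+-cong (mod-refl {i = i}) (∣⇒≋0 (subst (d ∣_) (ℕ.∣m-m+n∣≡n i k) d∣))) (mod-reflexive (ℕ.+-identityʳ i))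
  by-order : i ≤ j ⊎ j ≤ i → i ≋ j [mod d ]
  by-order (inj₁ i≤j) = mod-sym (ordered i≤j d∣)
  by-order (inj₂ j≤i) = ordered j≤i (subst (d ∣_) (ℕ.∣-∣-comm i j) d∣)

residue : ∀ {d} → ℕ → Fin (suc d)
residue {d} i = i mod suc d

module _ {d : ℕ} where

  toℕ-residue : ∀ i → toℕ (residue {d} i) ≋ i [mod suc d ]
  toℕ-residue i = mod-trans (mod-reflexive (Fin.toℕ-fromℕ< _)) (mod-% i)

  residue-cong : ∀ {i j} → i ≋ j [mod suc d ] → residue {d} i ≡ residue j
  residue-cong (congruent eq) = Fin.fromℕ<-cong _ _ eq _ _

  residue-injective : ∀ {i j} → residue {d} i ≡ residue j → i ≋ j [mod suc d ]
  residue-injective {i} {j} eq = mod-trans (mod-sym (toℕ-residue i))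
    (mod-trans (mod-reflexive (cong toℕ eq)) (toℕ-residue j))

  residue-toℕ : ∀ (j : Fin (suc d)) → residue (toℕ j) ≡ j
  residue-toℕ j = Fin.toℕ-injective (trans (Fin.toℕ-fromℕ< _) (m<n⇒m%n≡m (Fin.toℕ<n j)))

  sucMod-residue : ∀ i → sucMod (residue {d} i) ≡ residue (suc i)
  sucMod-residue i = residue-cong {suc (toℕ (residue i))} {suc i} (mod-+-cong (mod-refl {i = 1}) (toℕ-residue i))

  predMod-residue : ∀ i → predMod (residue {d} i) ≡ residue (i + d)
  predMod-residue i = residue-cong {toℕ (residue i) + d} {i + d} (mod-+-cong (toℕ-residue i) (mod-refl {i = d}))

  residue-from : ∀ q (j : Fin (suc d)) → ∃[ k ] k < suc d × residue (k + q) ≡ j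
  residue-from q j = k % suc d , m%n<n k (suc d) , trans (residue-cong k+q≋j) (residue-toℕ j)
    where
    -- This is `j − q` modulo `suc d`.
    k = toℕ j + q * d
    shuffle : ∀ j q d → j + q * d + q ≡ j + q * suc d
    shuffle = solve-∀
    k+q≋j : k % suc d + q ≋ toℕ j [mod suc d ]
    k+q≋j = mod-trans (mod-+-cong (mod-% k) (mod-refl {i = q}))
      (mod-trans (mod-reflexive (shuffle (toℕ j) q d)) (mod-+-multiple (toℕ j) q))

-- The map `Θ` simulated by the lifted dynamics.

-- Time and slots are counted in ℕ; going backwards means adding n (n − 1) − 1, which is −1 both
-- modulo n = suc (suc l) and modulo n − 1.
stride : ℕ → Sign → ℕ
stride l Sign.+ = 1
stride l Sign.- = suc l * suc l + l

-- The lift of `halfShift`: the label carried by the stone.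
gap : Sign → ℕ → ℕ
gap Sign.+ i = i
gap Sign.- i = suc i

module Simulation {l : ℕ} {G : EdgeLabel (suc (suc l))} (G-sym : ∀ u v → G u v ≡ G v u)
  {x₀ : Fin (suc (suc l))} (U : Unfolding G x₀ (suc l)) (sgn : Fin (suc (suc l)) → Sign)
  (e≡ : ∀ v → Unfolding.e U v ≡ stride l (sgn v))
  (sgn-refl : ∀ {u v} → Reach G x₀ u → G u v ≡ reflEdge → sgn v ≡ sgn u)
  (sgn-refr : ∀ {u v} → Reach G x₀ u → G u v ≡ refrEdge → sgn v ≡ opposite (sgn u))
  where

  open Unfolding U
  open Tour U using (ahead; κ; Φ; ahead-cross; κ-T)

  m n : ℕ
  m = suc l
  n = suc m

  τ : Permutation′ n → ℕ → Fin n
  τ σ p = σ ⟨$⟩ˡ residue p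

  τ-cong : ∀ σ {p q} → p ≋ q [mod n ] → τ σ p ≡ τ σ q
  τ-cong σ eq = cong (σ ⟨$⟩ˡ_) (residue-cong eq)

  -- Slot numbers lag one behind labels because the stone itself takes label `q`. Labels count
  -- modulo `n`, slots modulo `m`.
  Others : Permutation′ n → Fin n → ℕ → ℕ → Set
  Others σ x q r = ∀ k → k < r → τ σ (k + suc q) ≡ P x (a (k + q))

  Window : Permutation′ n → Fin n → ℕ → Set
  Window σ x q = τ σ q ≡ x × Others σ x q m

  -- The window seen from the index i, at which u and v sit: the stone is one of them.
  Around : Permutation′ n → Fin n → ℕ → Fin n → Fin n → Set
  Around σ x i u v = τ σ i ≡ u × τ σ (suc i) ≡ v × Others σ x (suc i) l

  wrap : ∀ σ i → τ σ (l + suc (suc i)) ≡ τ σ i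
  wrap σ i = τ-cong σ (mod-trans (mod-reflexive (shuffle l i)) (mod-+-multiple i 1))
    where
    shuffle : ∀ l i → l + suc (suc i) ≡ i + 1 * suc (suc l)
    shuffle = solve-∀

  wrap-ahead : ∀ x i → P x (a (l + suc i)) ≡ ahead i x
  wrap-ahead x i = cong (P x) (a-cong (mod-trans (mod-reflexive (shuffle l i)) (mod-+-multiple i 1)))
    where
    shuffle : ∀ l i → l + suc i ≡ i + 1 * suc l
    shuffle = solve-∀

  -- With either sign the stone's partner is the occupant of slot `i`: for a stone at label `suc i`,
  -- going once around leads to label `i` and, modulo `m`, to slot `i`.
  Oriented : Sign → Permutation′ n → Fin n → ℕ → Set
  Oriented Sign.+ σ x i = Around σ x i x (ahead i x)
  Oriented Sign.- σ x i = Around σ x i (ahead i x) x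

  Window⇒Oriented : ∀ s σ {x i} → Window σ x (gap s i) → Oriented s σ x i
  Window⇒Oriented Sign.+ σ {x} {i} (stone , others) = stone , others 0 (s≤s z≤n) , λ k k<l →
    subst₂ (λ p q → τ σ p ≡ P x (a q)) (sym (ℕ.+-suc k (suc i))) (sym (ℕ.+-suc k i)) (others (suc k) (s≤s k<l))
  Window⇒Oriented Sign.- σ {x} {i} (stone , others) =
    trans (sym (wrap σ i)) (trans (others l (ℕ.n<1+n l)) (wrap-ahead x i)) ,
    stone , λ k k<l → others k (ℕ.m<n⇒m<1+n k<l)

  Oriented⇒Window : ∀ s σ {x i} → Oriented s σ x i → Window σ x (gap s i)
  Oriented⇒Window Sign.+ σ {x} {i} (stone , next , others) = stone , λ where
    zero    _         → next
    (suc k) (s≤s k<l) →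
      subst₂ (λ p q → τ σ p ≡ P x (a q)) (ℕ.+-suc k (suc i)) (ℕ.+-suc k i) (others k k<l)
  Oriented⇒Window Sign.- σ {x} {i} (previous , stone , others) = stone , λ k k<m → by-cases k (k ℕ.<? l) k<m
    where
    by-cases : ∀ k → Dec (k < l) → k < m → τ σ (k + suc (suc i)) ≡ P x (a (k + suc i))
    by-cases k (yes k<l) _ = others k k<l
    by-cases k (no k≮l) (s≤s k≤l) with refl ← ℕ.≤-antisym k≤l (ℕ.≮⇒≥ k≮l) =
      trans (wrap σ i) (trans previous (sym (wrap-ahead x i)))

  Around-swap : ∀ σ {x i u v} → Around σ x i u v → Around (applyS (residue i) σ) x i v u
  Around-swap σ {x} {i} (τi , τsi , others) =
    trans (cong (σ ⟨$⟩ˡ_) (trans (transpose-ʳ (sucMod (residue i)) (residue i)) (sucMod-residue i))) τsi ,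
    trans (cong (σ ⟨$⟩ˡ_) (trans (cong (transpose (sucMod (residue i)) (residue i)) (sym (sucMod-residue i)))
      (transpose-ˡ (sucMod (residue i)) (residue i)))) τi ,
    λ k k<l → trans (cong (σ ⟨$⟩ˡ_) (transpose-≢ (≢si k k<l) (≢i k k<l))) (others k k<l)
    where
    ≢si : ∀ k → k < l → residue (k + suc (suc i)) ≢ sucMod (residue i)
    ≢si k k<l eq = ¬mod-+ {n} (suc k) (suc i) (s≤s z≤n) (s≤s (ℕ.m<n⇒m<1+n k<l))
      (subst (λ p → p ≋ suc i [mod n ]) (ℕ.+-suc k (suc i)) (residue-injective (trans eq (sucMod-residue i))))
    ≢i : ∀ k → k < l → residue (k + suc (suc i)) ≢ residue i
    ≢i k k<l eq = ¬mod-+ {n} (suc (suc k)) i (s≤s z≤n) (s≤s (s≤s k<l))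
      (subst (λ p → p ≋ i [mod n ]) (trans (ℕ.+-suc k (suc i)) (cong suc (ℕ.+-suc k i))) (residue-injective eq))

  -- The labelling stays and the role of the stone passes on. `P` changes by the transposition of
  -- the two vertices, which fixes the occupants of all slots but `i`.
  Around-cross : ∀ σ {x i u v} → T x → Adj G x (ahead i x) → Around σ x i u v → Around σ (ahead i x) i u v
  Around-cross σ {x} {i} r adj (τi , τsi , others) = τi , τsi , λ k k<l → trans (others k k<l) (begin
    P x (a (k + suc i))                             ≡⟨ transpose-≢ (P≢stone _ r) (≢ahead k k<l) ⟨
    transpose x (ahead i x) (P x (a (k + suc i)))   ≡⟨ P-step r adj _ ⟨
    P (ahead i x) (a (k + suc i))                   ∎)
    where
    open ≡-Reasoning
    ≢ahead : ∀ k → k < l → P x (a (k + suc i)) ≢ ahead i x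
    ≢ahead k k<l eq = ¬mod-+ {m} (suc k) i (s≤s z≤n) (s≤s k<l)
      (subst (λ p → p ≋ i [mod m ]) (ℕ.+-suc k i) (a-injective (P-injective r eq)))

  Oriented-swap : ∀ s σ {x i} → Oriented s σ x i → Oriented (opposite s) (applyS (residue i) σ) x i
  Oriented-swap Sign.+ σ = Around-swap σ
  Oriented-swap Sign.- σ = Around-swap σ

  Oriented-cross : ∀ s σ {x i} → T x → Adj G x (ahead i x) → Oriented s σ x i →
                   Oriented (opposite s) σ (ahead i x) i
  Oriented-cross Sign.+ σ {x} {i} r adj o =
    subst (λ z → Around σ (ahead i x) i z (ahead i x)) (sym (ahead-cross i r adj)) (Around-cross σ r adj o)
  Oriented-cross Sign.- σ {x} {i} r adj o =
    subst (Around σ (ahead i x) i (ahead i x)) (sym (ahead-cross i r adj)) (Around-cross σ r adj o)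

  Window-shift : ∀ σ {x q q′} → q ≋ q′ [mod n ] → q ≋ q′ [mod m ] → Window σ x q → Window σ x q′
  Window-shift σ {x} {q} {q′} eqₙ eqₘ (stone , others) =
    trans (τ-cong σ (mod-sym eqₙ)) stone , λ k k<m →
      trans (τ-cong σ (mod-+-cong (mod-refl {i = k}) (mod-+-cong (mod-refl {i = 1}) (mod-sym eqₙ))))
      (trans (others k k<m) (cong (P x) (a-cong (mod-+-cong (mod-refl {i = k}) eqₘ))))

  Window-unique : ∀ σ ρ {x q} → Window σ x q → Window ρ x q → ∀ j → σ ⟨$⟩ˡ j ≡ ρ ⟨$⟩ˡ j
  Window-unique σ ρ {x} {q} (stone , others) (stone′ , others′) j with residue-from q j
  ... | zero  , _ , refl = trans stone (sym stone′)
  ... | suc k , s≤s k<m , refl = subst (λ p → τ σ p ≡ τ ρ p) (ℕ.+-suc k q) (trans (others k k<m) (sym (others′ k k<m)))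

  record Simulates (ξ : Ξ n) (s : Fin n × ℕ) : Set where
    constructor simulates
    field
      reachable : T (proj₁ s)
      index≡    : proj₁ (proj₂ ξ) ≡ residue (proj₂ s)
      sign≡     : proj₂ (proj₂ ξ) ≡ sgn (proj₁ s)
      window    : Window (proj₁ ξ) (proj₁ s) (gap (sgn (proj₁ s)) (proj₂ s))

  -- A stone of new sign `s` must have ended up on the far side in its direction of travel: at
  -- `i + 1`, the gap of the next index `i + 1`, for `+`; at `i`, the gap of the next index `i − 1`,
  -- for `-`.
  advance : ∀ s σ {x i} → T x → sgn x ≡ s → Oriented (opposite s) σ x i →
            Simulates (σ , stepMod s (residue i) , s) (x , i + e x)
  advance Sign.+ σ {x} {i} r sgn≡ o = simulates r index (sym sgn≡) (subst (Window σ x) gap≡ (Oriented⇒Window Sign.- σ o))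
    where
    i+e : i + e x ≡ suc i
    i+e = trans (cong (i +_) (trans (e≡ x) (cong (stride l) sgn≡))) (ℕ.+-comm i 1)
    index : sucMod (residue i) ≡ residue (i + e x)
    index = trans (sucMod-residue i) (cong residue (sym i+e))
    gap≡ : suc i ≡ gap (sgn x) (i + e x)
    gap≡ = trans (sym i+e) (cong (λ s → gap s (i + e x)) (sym sgn≡))
  advance Sign.- σ {x} {i} r sgn≡ o = simulates r index (sym sgn≡)
    (subst (Window σ x) gap≡ (Window-shift σ (mod-sym back-n) (mod-sym back-m) (Oriented⇒Window Sign.+ σ o)))
    where
    e≡stride : e x ≡ stride l Sign.-
    e≡stride = trans (e≡ x) (cong (stride l) sgn≡)
    index : predMod (residue i) ≡ residue (i + e x)
    index = trans (predMod-residue i) (residue-cong (mod-sym (mod-trans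
      (mod-reflexive (trans (cong (i +_) e≡stride) (shuffle i l))) (mod-+-multiple (i + suc l) l))))
      where
      shuffle : ∀ i l → i + (suc l * suc l + l) ≡ i + suc l + l * suc (suc l)
      shuffle = solve-∀
    back-n : suc (i + stride l Sign.-) ≋ i [mod n ]
    back-n = mod-trans (mod-reflexive (shuffle i l)) (mod-+-multiple i m)
      where
      shuffle : ∀ i l → suc (i + (suc l * suc l + l)) ≡ i + suc l * suc (suc l)
      shuffle = solve-∀
    back-m : suc (i + stride l Sign.-) ≋ i [mod m ]
    back-m = mod-trans (mod-reflexive (shuffle i l)) (mod-+-multiple i n)
      where
      shuffle : ∀ i l → suc (i + (suc l * suc l + l)) ≡ i + suc (suc l) * suc l
      shuffle = solve-∀
    gap≡ : suc (i + stride l Sign.-) ≡ gap (sgn x) (i + e x)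
    gap≡ = trans (cong (λ d → suc (i + d)) (sym e≡stride)) (cong (λ s → gap s (i + e x)) (sym sgn≡))

  Θ-type : ∀ s σ {x i} → Oriented s σ x i → G (τ σ i) (σ ⟨$⟩ˡ sucMod (residue i)) ≡ G x (ahead i x)
  Θ-type Sign.+ σ {x} {i} (τi , τsi , _) =
    cong₂ G τi (trans (cong (σ ⟨$⟩ˡ_) (sucMod-residue i)) τsi)
  Θ-type Sign.- σ {x} {i} (τi , τsi , _) =
    trans (cong₂ G τi (trans (cong (σ ⟨$⟩ˡ_) (sucMod-residue i)) τsi)) (G-sym (ahead i x) x)

  -- Swapping the labels and changing the stone each reverse the orientation. A non-edge does the
  -- first, a reflection the second, and both keep the sign; a refraction does both and flips the
  -- sign. So the orientation always ends opposite to the new sign, as `advance` requires.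
  Θ-simulates-Φ : ∀ {ξ s} → Simulates ξ s → Simulates (Θ G ξ) (Φ s)
  Θ-simulates-Φ {σ , _ , _} {x , i} (simulates r refl refl window) =
    subst (λ t → Simulates (ΘCase t (σ , residue i , sgn x)) (Φ (x , i))) (sym (Θ-type (sgn x) σ oriented))
      (by-type (G x (ahead i x)) refl)
    where
    oriented : Oriented (sgn x) σ x i
    oriented = Window⇒Oriented (sgn x) σ window

    by-type : ∀ t → G x (ahead i x) ≡ t → Simulates (ΘCase t (σ , residue i , sgn x)) (cross t x (ahead i x) , i + e (cross t x (ahead i x)))
    by-type nonEdge  _  = advance (sgn x) _ r refl (Oriented-swap (sgn x) σ oriented)
    by-type reflEdge eq = advance (sgn x) σ (r ∷ʳ adj) (sgn-refl r eq) (Oriented-cross (sgn x) σ r adj oriented)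
      where
      adj : Adj G x (ahead i x)
      adj eq′ with trans (sym eq) eq′
      ... | ()
    by-type refrEdge eq = advance (opposite (sgn x)) _ (r ∷ʳ adj) (sgn-refr r eq)
      (Oriented-swap (opposite (sgn x)) σ (Oriented-cross (sgn x) σ r adj oriented))
      where
      adj : Adj G x (ahead i x)
      adj eq′ with trans (sym eq) eq′
      ... | ()

  -- Faithfulness of the simulation and the orbit size.

  gap-cong : ∀ {d} .{{_ : NonZero d}} s {i j} → i ≋ j [mod d ] → gap s i ≋ gap s j [mod d ]
  gap-cong Sign.+ eq = eq
  gap-cong Sign.- eq = mod-+-cong (mod-refl {i = 1}) eq

  gap-cancel : ∀ {d} .{{_ : NonZero d}} s {i j} → gap s i ≋ gap s j [mod d ] → i ≋ j [mod d ]
  gap-cancel Sign.+ eq = eq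
  gap-cancel Sign.- eq = mod-+-cancelˡ 1 _ _ eq

  simulates-unique : ∀ {ξ ξ′ u i j} → Simulates ξ (u , i) → Simulates ξ′ (u , j) →
                     i ≋ j [mod n ] → i ≋ j [mod m ] → ξ ≈Ξ ξ′
  simulates-unique {σ , _} {ρ , _} {u} {i} {j} (simulates _ refl refl window) (simulates _ refl refl window′) eqₙ eqₘ =
    σ≈ρ , residue-cong eqₙ , refl
    where
    σˡ≈ρˡ : ∀ k → σ ⟨$⟩ˡ k ≡ ρ ⟨$⟩ˡ k
    σˡ≈ρˡ = Window-unique σ ρ (Window-shift σ (gap-cong (sgn u) eqₙ) (gap-cong (sgn u) eqₘ) window) window′
    σ≈ρ : ∀ v → σ ⟨$⟩ʳ v ≡ ρ ⟨$⟩ʳ v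
    σ≈ρ v = begin
      σ ⟨$⟩ʳ v                          ≡⟨ inverseʳ ρ ⟨
      ρ ⟨$⟩ʳ (ρ ⟨$⟩ˡ (σ ⟨$⟩ʳ v))        ≡⟨ cong (ρ ⟨$⟩ʳ_) (σˡ≈ρˡ _) ⟨
      ρ ⟨$⟩ʳ (σ ⟨$⟩ˡ (σ ⟨$⟩ʳ v))        ≡⟨ cong (ρ ⟨$⟩ʳ_) (inverseˡ σ) ⟩
      ρ ⟨$⟩ʳ v                          ∎
      where open ≡-Reasoning

  -- Index and sign locate the label of the stone, hence the stone. The vertex at the following
  -- label then determines the slot modulo `m`.
  simulates-injective : ∀ {ξ ξ′ u v i j} → Simulates ξ (u , i) → Simulates ξ′ (v , j) → ξ ≈Ξ ξ′ →
                        u ≡ v × i ≋ j [mod n ] × i ≋ j [mod m ]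
  simulates-injective {σ , _} {ρ , _} {u} {v} {i} {j}
    (simulates r refl refl (stone , others)) (simulates _ refl refl (stone′ , others′)) (σ≈ρ , index≡ , sgn≡) =
    u≡v , i≋j , gap-cancel (sgn u) (subst (λ s → gap (sgn u) i ≋ gap s j [mod m ]) (sym sgn≡) slots)
    where
    i≋j : i ≋ j [mod n ]
    i≋j = residue-injective index≡
    gap≋ : gap (sgn u) i ≋ gap (sgn v) j [mod n ]
    gap≋ = subst (λ s → gap (sgn u) i ≋ gap s j [mod n ]) sgn≡ (gap-cong (sgn u) i≋j)
    σˡ≈ρˡ : ∀ k → σ ⟨$⟩ˡ k ≡ ρ ⟨$⟩ˡ k
    σˡ≈ρˡ k = begin
      σ ⟨$⟩ˡ k                     ≡⟨ inverseˡ ρ ⟨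
      ρ ⟨$⟩ˡ (ρ ⟨$⟩ʳ (σ ⟨$⟩ˡ k))   ≡⟨ cong (ρ ⟨$⟩ˡ_) (σ≈ρ _) ⟨
      ρ ⟨$⟩ˡ (σ ⟨$⟩ʳ (σ ⟨$⟩ˡ k))   ≡⟨ cong (ρ ⟨$⟩ˡ_) (inverseʳ σ) ⟩
      ρ ⟨$⟩ˡ k                     ∎
      where open ≡-Reasoning
    τ≡ : ∀ {p q} → p ≋ q [mod n ] → τ σ p ≡ τ ρ q
    τ≡ eq = trans (τ-cong σ eq) (σˡ≈ρˡ _)
    u≡v : u ≡ v
    u≡v = trans (sym stone) (trans (τ≡ gap≋) stone′)
    slots : gap (sgn u) i ≋ gap (sgn v) j [mod m ]
    slots = a-injective (P-injective r (trans (sym (others 0 (s≤s z≤n)))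
      (trans (τ≡ (mod-+-cong (mod-refl {i = 1}) gap≋))
      (trans (others′ 0 (s≤s z≤n)) (cong (λ z → P z (a (gap (sgn v) j))) (sym u≡v))))))

  open Tour U using (x; p; K; drift; after-rK; after-rK-mod; Return⇒K∣)

  simulates-iterate : ∀ {ξ} → Simulates ξ (x₀ , i₀) → ∀ t → Simulates (iterate (Θ G) t ξ) (x t , p t)
  simulates-iterate sim zero    = sim
  simulates-iterate sim (suc t) = Θ-simulates-Φ (simulates-iterate sim t)

  -- An exact return needs the stone and the index modulo both `m` and `n`. The first two force `q`
  -- whole laps, after which the index has moved by `q * drift`.
  orbitSize : ∀ {ξ} → Simulates ξ (x₀ , i₀) → ∀ r → 0 < r →
              (n ∣ r * drift) → (∀ q → n ∣ q * drift → r ∣ q) → OrbitSize G ξ (r * K)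
  orbitSize {ξ} sim r 0<r n∣ minimal = ℕ.*-mono-≤ 0<r (s≤s z≤n) , closed , first
    where
    p≡ : ∀ q → p (q * K) ≡ i₀ + q * drift
    p≡ q = proj₂ (after-rK q 0)
    closed : iterate (Θ G) (r * K) ξ ≈Ξ ξ
    closed = simulates-unique {iterate (Θ G) (r * K) ξ}
      (subst (λ v → Simulates (iterate (Θ G) (r * K) ξ) (v , p (r * K))) (proj₁ (after-rK r 0)) (simulates-iterate sim (r * K))) sim
      (mod-trans (mod-reflexive (p≡ r)) (mod-trans (mod-+-cong (mod-refl {i = i₀}) (∣⇒≋0 n∣)) (mod-reflexive (ℕ.+-identityʳ i₀))))
      (proj₂ (after-rK-mod r 0))
    first : ∀ j → 0 < j → j < r * K → ¬ (iterate (Θ G) j ξ ≈Ξ ξ)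
    first j 0<j j<rK eq with simulates-injective (simulates-iterate sim j) sim eq
    ... | x≡ , p≋ₙ , p≋ₘ with Return⇒K∣ {j} (x≡ , p≋ₘ)
    ...   | divides q refl = ℕ.<⇒≱ j<rK (ℕ.*-monoˡ-≤ K (∣⇒≤ {{q≢0}} (minimal q n∣q*drift)))
      where
      q≢0 : NonZero q
      q≢0 = ℕ.m*n≢0⇒m≢0 q {K} {{>-nonZero 0<j}}
      n∣q*drift : n ∣ q * drift
      n∣q*drift = ≋0⇒∣ (mod-+-cancelˡ i₀ (q * drift) 0
        (mod-trans (mod-reflexive (sym (p≡ q))) (mod-trans p≋ₙ (mod-reflexive (sym (ℕ.+-identityʳ i₀))))))

-- Signs from the colouring; the drift and the gcd.

colourSign : Sign → Bool → Sign
colourSign s true  = s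
colourSign s false = opposite s

colourSign-≢ : ∀ s {b b′} → b ≢ b′ → colourSign s b′ ≡ opposite (colourSign s b)
colourSign-≢ s {true}  {true}  b≢ = contradiction refl b≢
colourSign-≢ s {true}  {false} b≢ = refl
colourSign-≢ s {false} {true}  b≢ = sym (opposite-involutive s)
colourSign-≢ s {false} {false} b≢ = contradiction refl b≢

colourSign-involutive : ∀ s b → colourSign (colourSign s b) b ≡ s
colourSign-involutive s true  = refl
colourSign-involutive s false = opposite-involutive s

sum-by-colour : ∀ {A : Set} (f : Bool → ℕ) (c : A → Bool) L →
  sum (map (f ∘ c) L) ≡ length (filterᵇ c L) * f true + length (filterᵇ (not ∘ c) L) * f false
sum-by-colour f c []      = refl
sum-by-colour f c (v ∷ L) with c v
... | true  = trans (cong (f true +_) (sum-by-colour f c L))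
  (sym (ℕ.+-assoc (f true) _ _))
... | false = trans (cong (f false +_) (sum-by-colour f c L))
  (shuffle (f false) (length (filterᵇ c L) * f true) _)
  where
  shuffle : ∀ i j k → i + (j + k) ≡ j + (i + k)
  shuffle = solve-∀

-- Modulo n = suc (suc l), both n − 1 and the backward stride are −1.
drift-balance : ∀ l A B → suc l * (A * stride l Sign.+ + B * stride l Sign.-) + A ≋ B [mod suc (suc l) ]
drift-balance l A B = mod-trans (mod-reflexive (expand l A B)) (mod-+-multiple B (A + B * (l * suc (suc l))))
  where
  expand : ∀ l A B → suc l * (A * 1 + B * (suc l * suc l + l)) + A ≡ B + (A + B * (l * suc (suc l))) * suc (suc l)
  expand = solve-∀

module _ {d} .{{_ : NonZero d}} {D A B : ℕ} (balance : D + A ≋ B [mod d ]) where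

  private
    scaled : ∀ q → q * D + q * A ≋ q * B [mod d ]
    scaled q = mod-trans (mod-reflexive (sym (ℕ.*-distribˡ-+ q D A))) (mod-*-cong (mod-refl {i = q}) balance)

  -- `balance` says, without subtraction, that `D` is `B − A` modulo `d`.
  ∣drift⇒∣difference : ∀ q → d ∣ q * D → d ∣ q * ∣ A - B ∣
  ∣drift⇒∣difference q d∣ = subst (d ∣_) (sym (ℕ.*-distribˡ-∣-∣ q A B)) (≋⇒∣ (q * A) (q * B)
    (mod-trans (mod-sym (mod-+-cong (∣⇒≋0 d∣) (mod-refl {i = q * A}))) (scaled q)))

  ∣difference⇒∣drift : ∀ q → d ∣ q * ∣ A - B ∣ → d ∣ q * D
  ∣difference⇒∣drift q d∣ = ≋0⇒∣ (mod-+-cancelʳ (q * D) 0 (q * A)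
    (mod-trans (scaled q) (mod-sym (∣⇒≋ (q * A) (q * B) (subst (d ∣_) (ℕ.*-distribˡ-∣-∣ q A B) d∣)))))

-- `n` divides both `q * n` and `q * χ`, hence their gcd `q * gcd n χ`; cancel the factor `gcd n χ`
-- of `n`.
∣-multiple⇒∣ : ∀ {n r} χ q .{{n≢0 : NonZero n}} → n ≡ r * gcd n χ → n ∣ q * χ → r ∣ q
∣-multiple⇒∣ {n} {r} χ q {{n≢0}} n≡ n∣ = *-cancelʳ-∣ (gcd n χ) {{g≢0}}
  (subst₂ _∣_ n≡ (sym (c*gcd[m,n]≡gcd[cm,cn] q n χ)) (gcd-greatest (divides q refl) n∣))
  where
  g≢0 : NonZero (gcd n χ)
  g≢0 = ℕ.m*n≢0⇒n≢0 r {{subst NonZero n≡ n≢0}}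

∣⇒∣-multiple : ∀ {n} r χ → n ≡ r * gcd n χ → n ∣ r * χ
∣⇒∣-multiple {n} r χ n≡ with gcd[m,n]∣n n χ
... | divides t χ≡ = divides t (begin
  r * χ              ≡⟨ cong (r *_) χ≡ ⟩
  r * (t * gcd n χ)  ≡⟨ shuffle r t _ ⟩
  t * (r * gcd n χ)  ≡⟨ cong (t *_) n≡ ⟨
  t * n              ∎)
  where
  open ≡-Reasoning
  shuffle : ∀ r t g → r * (t * g) ≡ t * (r * g)
  shuffle = solve-∀

-- The initial configuration and its orbit.

module Start {l : ℕ} (G : EdgeLabel (suc (suc l))) (simple : IsSimple G) (forest : IsForest G)
  (σ : Permutation′ (suc (suc l))) (i : Fin (suc (suc l))) (ε : Sign)
  (L : List (Fin (suc (suc l)))) (component : IsComponentList G (σ ⟨$⟩ˡ halfShift ε i) L)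
  (c : Fin (suc (suc l)) → Bool) (partition : IsReflRefrPartition G (σ ⟨$⟩ˡ halfShift ε i) c) where

  open Forest G simple forest
  open Walks G

  m n : ℕ
  m = suc l
  n = suc m

  x₀ : Fin n
  x₀ = σ ⟨$⟩ˡ halfShift ε i

  -- The sign of the colour `true`, chosen so that `x₀` receives `ε`.
  s : Sign
  s = colourSign ε (c x₀)

  sgn : Fin n → Sign
  sgn v = colourSign s (c v)

  sgn-x₀ : sgn x₀ ≡ ε
  sgn-x₀ = colourSign-involutive ε (c x₀)

  q₀ : ℕ
  q₀ = gap ε (toℕ i)

  gap-residue : residue q₀ ≡ halfShift ε i
  gap-residue = by-sign ε
    where
    by-sign : ∀ ε → residue (gap ε (toℕ i)) ≡ halfShift ε i
    by-sign Sign.+ = residue-toℕ i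
    by-sign Sign.- = refl

  σˡ-injective : ∀ {j k} → σ ⟨$⟩ˡ j ≡ σ ⟨$⟩ˡ k → j ≡ k
  σˡ-injective eq = trans (sym (inverseʳ σ)) (trans (cong (σ ⟨$⟩ʳ_) eq) (inverseʳ σ))

  -- The representative of `k − q₀` modulo `m`, since `l` is -1 there. Reducing before passing to
  -- labels makes `a` periodic modulo `m` although labels live modulo `n`.
  slot : ℕ → ℕ
  slot k = (k + l * q₀) % m

  a : ℕ → Fin n
  a k = σ ⟨$⟩ˡ residue (slot k + suc q₀)

  slot-+q₀ : ∀ {k} → k < m → slot (k + q₀) ≡ k
  slot-+q₀ {k} k<m = trans (remainders (mod-trans (mod-reflexive (shuffle k q₀ l)) (mod-+-multiple k q₀))) (m<n⇒m%n≡m k<m)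
    where
    shuffle : ∀ k q l → k + q + l * q ≡ k + q * suc l
    shuffle = solve-∀

  a-+q₀ : ∀ {k} → k < m → a (k + q₀) ≡ σ ⟨$⟩ˡ residue (k + suc q₀)
  a-+q₀ k<m = cong (λ k → σ ⟨$⟩ˡ residue (k + suc q₀)) (slot-+q₀ k<m)

  slot<n : ∀ k → slot k < n
  slot<n k = ℕ.m<n⇒m<1+n (m%n<n (k + l * q₀) m)

  a-injective : ∀ {j k} → a j ≡ a k → j ≋ k [mod m ]
  a-injective {j} {k} eq = mod-+-cancelʳ j k (l * q₀) (congruent (begin
    slot j      ≡⟨ m<n⇒m%n≡m (slot<n j) ⟨
    slot j % n  ≡⟨ remainders (mod-+-cancelʳ (slot j) (slot k) (suc q₀) (residue-injective (σˡ-injective eq))) ⟩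
    slot k % n  ≡⟨ m<n⇒m%n≡m (slot<n k) ⟩
    slot k      ∎))
    where open ≡-Reasoning

  a≢x₀ : ∀ k → a k ≢ x₀
  a≢x₀ k eq = ¬mod-+ {n} (suc (slot k)) q₀ (s≤s z≤n) (s≤s (m%n<n (k + l * q₀) m))
    (mod-trans (mod-reflexive (sym (ℕ.+-suc (slot k) q₀)))
      (residue-injective (trans (σˡ-injective eq) (sym gap-residue))))

  a-surjective : ∀ {w} → w ≢ x₀ → ∃[ k ] a k ≡ w
  a-surjective {w} w≢x₀ with residue-from q₀ (σ ⟨$⟩ʳ w)
  ... | zero  , _ , eq = contradiction (trans (sym (inverseˡ σ)) (cong (σ ⟨$⟩ˡ_) (trans (sym eq) gap-residue))) w≢x₀
  ... | suc k , s≤s k<m , eq = k + q₀ , trans (a-+q₀ k<m)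
    (trans (cong (λ p → σ ⟨$⟩ˡ residue p) (ℕ.+-suc k q₀)) (trans (cong (σ ⟨$⟩ˡ_) eq) (inverseˡ σ)))

  -- Uses the walk that `component` supplies; by `transport-unique` any other would do. Outside the
  -- component the identity is a default.
  P : Fin n → Fin n → Fin n
  P v w with _∈?_ _≟_ v L
  ... | yes v∈L = transport (proj₁ (proj₂ component v) v∈L) w
  ... | no _    = w

  P-transport : ∀ {v} (r : Reach G x₀ v) w → P v w ≡ transport r w
  P-transport {v} r w with _∈?_ _≟_ v L
  ... | yes v∈L = transport-unique (proj₁ (proj₂ component v) v∈L) r w
  ... | no v∉L  = contradiction (proj₂ (proj₂ component v) r) v∉L

  stride² : ∀ s → stride l s * stride l s ≋ 1 [mod m ]
  stride² Sign.+ = mod-refl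
  stride² Sign.- = mod-trans (mod-reflexive (expand l)) (mod-+-multiple 1 (suc (suc l) * (l * l + 3 * l)))
    where
    expand : ∀ l → (suc l * suc l + l) * (suc l * suc l + l) ≡ 1 + (suc (suc l) * (l * l + 3 * l)) * suc l
    expand = solve-∀

  U : Unfolding G x₀ m
  U = record
    { Adj-sym      = Adj-sym
    ; Adj-irrefl   = Adj-irrefl
    ; P            = P
    ; P-transport  = P-transport
    ; a            = a
    ; a-cong       = λ eq → cong (λ k → σ ⟨$⟩ˡ residue (k + suc q₀)) (remainders (mod-+-cong eq (mod-refl {i = l * q₀})))
    ; a-injective  = a-injective
    ; a≢x₀         = a≢x₀
    ; a-surjective = a-surjective
    ; e            = stride l ∘ sgn
    ; e²≡1         = stride² ∘ sgn
    ; i₀           = toℕ i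
    }

  open Simulation (proj₁ simple) U sgn (λ _ → refl)
    (λ r eq → cong (colourSign s) (sym (proj₁ (partition _ _ r) eq)))
    (λ r eq → colourSign-≢ s (proj₂ (partition _ _ r) eq))
    using (Simulates; simulates; Window; orbitSize)
  open Tour U using (K; drift; K≡; drift≡)

  start : Simulates (σ , i , ε) (x₀ , toℕ i)
  start = simulates here (sym (residue-toℕ i)) (sym sgn-x₀)
    (subst (λ s → Window σ x₀ (gap s (toℕ i))) (sym sgn-x₀)
      (cong (σ ⟨$⟩ˡ_) gap-residue , λ k k<m → sym (trans (P-transport here _) (a-+q₀ k<m))))

  colours : Bool → ℕ
  colours true  = length (filterᵇ c L)
  colours false = length (filterᵇ (not ∘ c) L)

  -- `A` and `B` count the component's vertices of positive and negative sign. Which colour is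
  -- positive depends on `s`; the absolute difference does not.
  drift-balanced : ∃[ A ] ∃[ B ] drift + A ≋ B [mod n ] × ∣ A - B ∣ ≡ chi L c
  drift-balanced = by-sign s refl
    where
    drift≡sum : drift ≡ m * (colours true * stride l s + colours false * stride l (opposite s))
    drift≡sum = trans
      (drift≡ (proj₁ component) (λ {v} → proj₁ (proj₂ component v)) (λ {v} → proj₂ (proj₂ component v)))
      (cong (m *_) (sum-by-colour (stride l ∘ colourSign s) c L))

    by-sign : ∀ t → s ≡ t → ∃[ A ] ∃[ B ] drift + A ≋ B [mod n ] × ∣ A - B ∣ ≡ chi L c
    by-sign Sign.+ s≡ = colours true , colours false ,
      mod-trans (mod-reflexive (cong (_+ colours true) (trans drift≡sum
        (cong (λ s → m * (colours true * stride l s + colours false * stride l (opposite s))) s≡))))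
        (drift-balance l (colours true) (colours false)) , refl
    by-sign Sign.- s≡ = colours false , colours true ,
      mod-trans (mod-reflexive (cong (_+ colours false) (trans drift≡sum (trans
        (cong (λ s → m * (colours true * stride l s + colours false * stride l (opposite s))) s≡)
        (cong (m *_) (ℕ.+-comm (colours true * stride l Sign.-) _))))))
        (drift-balance l (colours false) (colours true)) , ℕ.∣-∣-comm (colours false) (colours true)

  orbit : Σ[ N ∈ ℕ ] ((N * gcd n (chi L c) ≡ length L * n * m) × OrbitSize G (σ , i , ε) N)
  orbit with gcd[m,n]∣m n (chi L c) | drift-balanced
  -- `r` is `n / gcd n χ`, the number of laps.
  ... | divides r n≡ | A , B , balance , χ≡ = r * K , size≡ ,
    orbitSize start r r>0
      (∣difference⇒∣drift balance r (subst (λ χ → n ∣ r * χ) (sym χ≡) (∣⇒∣-multiple r (chi L c) n≡)))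
      (λ q n∣ → ∣-multiple⇒∣ (chi L c) q n≡ (subst (λ χ → n ∣ q * χ) χ≡ (∣drift⇒∣difference balance q n∣)))
    where
    r>0 : 0 < r
    r>0 = ℕ.n≢0⇒n>0 λ r≡0 → ℕ.1+n≢0 (trans n≡ (cong (_* gcd n (chi L c)) r≡0))
    size≡ : r * K * gcd n (chi L c) ≡ length L * n * m
    size≡ = begin
      r * K * gcd n (chi L c)      ≡⟨ shuffle r K _ ⟩
      K * (r * gcd n (chi L c))    ≡⟨ cong (K *_) n≡ ⟨
      K * n                        ≡⟨ cong (_* n) (K≡ (proj₁ component) (λ {v} → proj₁ (proj₂ component v)) (λ {v} → proj₂ (proj₂ component v))) ⟩
      length L * m * n             ≡⟨ shuffle′ (length L) m n ⟩
      length L * n * m             ∎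
      where
      open ≡-Reasoning
      shuffle : ∀ r K g → r * K * g ≡ K * (r * g)
      shuffle = solve-∀
      shuffle′ : ∀ k m n → k * m * n ≡ k * n * m
      shuffle′ = solve-∀

theorem1p2 : (n : ℕ) → 3 ≤ n → (G : EdgeLabel n) → IsSimple G → IsForest G →
    (σ : Permutation′ n) (i : Fin n) (ε : Sign) →
    (L : List (Fin n)) → IsComponentList G (σ ⟨$⟩ˡ halfShift ε i) L →
    (c : Fin n → Bool) → IsReflRefrPartition G (σ ⟨$⟩ˡ halfShift ε i) c →
    Σ[ N ∈ ℕ ] ((N * gcd n (chi L c) ≡ length L * n * (n ∸ 1)) ×
    OrbitSize G (σ , i , ε) N)
theorem1p2 (suc (suc l)) _ G simple forest σ i ε L component c partition =
  Start.orbit G simple forest σ i ε L component c partition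
theorem1p2 zero ()
theorem1p2 (suc zero) (s≤s ())
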